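{- Let $n\in\mathbb N$. For a Lawvere-Tierney topology $j$ on the category $\mathsf{sSet}^{\leq n}$ of $n$-dimensional simplicial sets, let $F^{ -1}jF\colon\Omega_+\to\Omega_+$ be the family $(F_k^{ -1}\circ j_k\circ F_k)_{0\le k\le n}$, which is a Lawvere-Tierney topology on $\mathsf{sSet}^{\leq n}_+$. A topology $j^w$ on $\mathsf{sSet}^{\leq n}_+$ (with $w\in\{0,1\}^{n+1}$) is in the image of the map $j\mapsto F^{ -1}jF$ if and only if $w=0^m1^{n+1-m}$ for some $0\le m\le n+1$. In other words, $j\mapsto F^{ -1}jF$ is a bijection from the set of topologies on $\mathsf{sSet}^{\leq n}$ to the set $\{\,j^w \mid j^w \text{ is a topology on } \mathsf{sSet}^{\leq n}_+ \text{ and } w=0^m1^{n+1-m}\text{ for some }0\le m\le n+1\,\}$.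
   Context: $\mathbb N$ contains $0$. $\Delta^{\leq n}$ is the category with objects $0,\dots,n$ ($k$ standing for the ordinal $\{0<\dots<k\}$) and monotone maps; $\Delta^{\leq n}_+$ is its wide subcategory of injective monotone maps. In the opposite category, $d_i=d^k_i\colon k\to k-1$ is the opposite of the injection omitting $i$, and $s_i=s^k_i\colon k\to k+1$ is the opposite of the monotone surjection hitting $i$ twice ($0\le i\le k$). $\mathsf{sSet}^{\leq n}$ and $\mathsf{sSet}^{\leq n}_+$ are the categories of presheaves of sets on $\Delta^{\leq n}$ and $\Delta^{\leq n}_+$. Write $y,\Omega$ for the Yoneda embedding and classifying object of $\mathsf{sSet}^{\leq n}$, and $y_+,\Omega_+$ for those of $\mathsf{sSet}^{\leq n}_+$: $\Omega(k)$ is the Heyting algebra of subpresheaves of $y(k)$, and $\Omega(f)$ for $f\colon k\to l$ in the opposite category is pullback along $y(f^{\mathrm{op}})\colon y(l)\to y(k)$; similarly for $\Omega_+$. A (Lawvere-Tierney) topology is a natural transformation $j$ from the classifying object to itself that, at each $k$, preserves the top element, is idempotent, and preserves binary meets. For $x\in\Omega_+(k)$, define sets of degenerate simplices $\mathrm{degen}(x,0)=\emptyset$ and $\mathrm{degen}(x,l+1)=\{s^l_i\circ f\in(\Delta^{\leq n})^{\mathrm{op}}(k,l+1)\mid f\in x(l)\cup\mathrm{degen}(x,l),\ 0\le i\le l\}$; the same definition is used for $x\in\Omega(k)$. The maps $F_k\colon\Omega_+(k)\to\Omega(k)$, $F_k(x)(l)=x(l)\cup\mathrm{degen}(x,l)$,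 and $F_k^{ -1}\colon\Omega(k)\to\Omega_+(k)$, $F_k^{ -1}(x)(l)=x(l)\setminus\mathrm{degen}(x,l)$, are mutually inverse. The topologies $j^w$ on $\mathsf{sSet}^{\leq n}_+$. $y_+(k)^\partial$ is the union of the faces of $y_+(k)$, where the $i$-th face is the least subpresheaf of $y_+(k)$ containing $d^k_i$; $y_+(0)^\partial=\emptyset$. The incidence tuple of $x\in\Omega_+(k+1)$ is $(\Omega_+(d_{k+1})(x),\dots,\Omega_+(d_0)(x))$. Recursively (identifying the sets $\Omega_+(k)$, $k\le n$, computed in dimension bounds $n$ and $n+1$): for $n=0$, $\Omega_+(0)=\{\emptyset,y_+(0)\}$, $j^0$ is the identity and $j^1$ is constant with value $y_+(0)$. Given $j^w$ with $w\in\{0,1\}^{n+1}$ and a bit $b$, put $j=j^{wb}$ with $j_k=j^w_k$ for $k\le n$, and: $j_{n+1}(y_+(n+1))=y_+(n+1)$; $j_{n+1}(y_+(n+1)^\partial)=y_+(n+1)^\partial$ if $b=0$ and $=y_+(n+1)$ if $b=1$; for $x<y_+(n+1)^\partial$ let $\vec z=(j_n\Omega_+(d_{n+1})(x),\dots,j_n\Omega_+(d_0)(x))$. If $\vec z\ne(y_+(n),\dots,y_+(n))$, $j_{n+1}(x)$ is the unique element with incidence tuple $\vec z$; otherwise $j_{n+1}(x)=y_+(n+1)^\partial$ if $b=0$ and $=y_+(n+1)$ if $b=1$. These $j^w$ are all the topologies on $\mathsf{sSet}^{\leq n}_+$. -}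

module Defs where

open import Data.Bool using (Bool; true; false; T; _∧_; if_then_else_)
open import Data.Bool.Properties using (T-∧; T-≡; T?) renaming (_≟_ to _≟ᵇ_)
open import Data.Empty using (⊥; ⊥-elim)
open import Data.Fin as Fin using (Fin; zero; suc; toℕ; fromℕ<; inject₁; punchIn; punchOut; pinch)
open import Data.Fin.Properties using
  ( any?; all?; suc-injective; toℕ-injective; toℕ<n; toℕ-fromℕ<; toℕ-inject₁; <-cmp
  ; punchIn-mono-≤; punchIn-injective; punchIn-punchOut; punchOut-mono-≤; punchOut-injective
  ; pinch-mono-≤ )
  renaming (_≟_ to _≟ᶠ_; _≤?_ to _≤ᶠ?_; ≤-antisym to ≤ᶠ-antisym; ≤-refl to ≤ᶠ-refl; ≤-total to ≤ᶠ-total)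
open import Data.List using (_++_; replicate)
open import Data.Nat as ℕ using (ℕ; zero; suc; _∸_; _≤_; s≤s)
open import Data.Nat.Properties using (<⇒≤; ≤-pred; <-≤-trans; ≤-reflexive; ≤-trans; n≤1+n)
open import Data.Product using (Σ; Σ-syntax; ∃; ∃-syntax; _×_; _,_; proj₁; proj₂)
open import Data.Sum using (_⊎_; inj₁; inj₂)
open import Data.Unit using (tt)
open import Data.Vec using (Vec; []; _∷_; lookup; tabulate; toList)
open import Data.Vec.Properties using (lookup∘tabulate; tabulate∘lookup; tabulate-cong; ≡-dec)
open import Function using (id; case_of_; module Equivalence)
open import Relation.Binary.Definitions using (tri<; tri≈; tri>)
open import Relation.Binary.PropositionalEquality
  using (_≡_; _≢_; refl; sym; trans; cong; subst; subst₂; module ≡-Reasoning)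
open import Relation.Nullary using (¬_; Dec; yes; no; contradiction)
open import Relation.Nullary.Decidable
  using (map′; ⌊_⌋; ¬?; _×-dec_; _⊎-dec_; _→-dec_; toWitness; fromWitness; recompute; decidable-stable)

-- Search stands in for finiteness: it makes quantification over
-- objects and morphisms decidable.
Searchable : Set → Set₁
Searchable A = {P : A → Set} → (∀ x → Dec (P x)) → Dec (∃ P)

record FinCat : Set₁ where
  infix  4 _⇒_
  infixr 9 _∘_
  field
    Obj        : Set
    _⇒_        : Obj → Obj → Set
    idn        : ∀ {a} → a ⇒ a
    _∘_        : ∀ {a b c} → b ⇒ c → a ⇒ b → a ⇒ c
    identityˡ  : ∀ {a b} (f : a ⇒ b) → idn ∘ f ≡ f
    identityʳ  : ∀ {a b} (f : a ⇒ b) → f ∘ idn ≡ f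
    assoc      : ∀ {a b c d} (f : c ⇒ d) (g : b ⇒ c) (h : a ⇒ b) →
                 (f ∘ g) ∘ h ≡ f ∘ (g ∘ h)
    searchObj  : Searchable Obj
    searchHom  : ∀ {a b} → Searchable (a ⇒ b)

module Classifier (C : FinCat) where
  open FinCat C

  -- A subpresheaf of the representable y(a).  Hom-sets are finite, so
  -- their (classical) subsets are given by Bool-valued membership.
  record Ω (a : Obj) : Set where
    field
      mem    : ∀ {b} → b ⇒ a → Bool
      closed : ∀ {b c} (f : b ⇒ a) (g : c ⇒ b) → T (mem f) → T (mem (f ∘ g))
  open Ω public

  infix 4 _∈_ _≈_ _≈?_

  _∈_ : ∀ {a b} → b ⇒ a → Ω a → Set
  f ∈ x = T (mem x f)

  _≈_ : ∀ {a} → Ω a → Ω a → Set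
  x ≈ y = ∀ {b} (f : b ⇒ _) → mem x f ≡ mem y f

  _≈?_ : ∀ {a} (x y : Ω a) → Dec (x ≈ y)
  x ≈? y =
    map′ (λ ¬p {b} f → decidable-stable (mem x f ≟ᵇ mem y f) (λ ne → ¬p (b , f , ne)))
         (λ e (b , f , ne) → ne (e f))
         (¬? (searchObj (λ b → searchHom (λ (f : b ⇒ _) → ¬? (mem x f ≟ᵇ mem y f)))))

  comprehension : ∀ {a} {P : ∀ {b} → b ⇒ a → Set} →
                  (∀ {b} (f : b ⇒ a) → Dec (P f)) →
                  (∀ {b c} (f : b ⇒ a) (g : c ⇒ b) → P f → P (f ∘ g)) →
                  Ω a
  comprehension P? P-closed = record
    { mem    = λ f → ⌊ P? f ⌋
    ; closed = λ f g p → fromWitness (P-closed f g (toWitness p))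
    }

  -- The top element of Ω(a), that is y(a) itself.
  ⊤ : ∀ {a} → Ω a
  ⊤ = record { mem = λ _ → true ; closed = λ _ _ _ → tt }

  infixr 7 _⊓_
  _⊓_ : ∀ {a} → Ω a → Ω a → Ω a
  x ⊓ y = record
    { mem    = λ f → mem x f ∧ mem y f
    ; closed = λ f g p → let (q , r) = Equivalence.to T-∧ p in
                 Equivalence.from T-∧ (closed x f g q , closed y f g r)
    }

  -- The action of Ω on the opposite of f : pullback along y(f).
  Ω[_] : ∀ {a b} → a ⇒ b → Ω b → Ω a
  Ω[ f ] x = record
    { mem    = λ g → mem x (f ∘ g)
    ; closed = λ g h p → subst (_∈ x) (assoc f g h) (closed x (f ∘ g) h p)
    }

  Operator : Set
  Operator = ∀ a → Ω a → Ω a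

  infix 4 _≋_
  _≋_ : Operator → Operator → Set
  j ≋ j′ = ∀ a (x : Ω a) → j a x ≈ j′ a x

  record IsTopology (j : Operator) : Set where
    field
      cong-≈      : ∀ {a} {x y : Ω a} → x ≈ y → j a x ≈ j a y
      natural     : ∀ {a b} (f : a ⇒ b) (x : Ω b) → j a (Ω[ f ] x) ≈ Ω[ f ] (j b x)
      preserves-⊤ : ∀ {a} → j a ⊤ ≈ ⊤
      idempotent  : ∀ {a} (x : Ω a) → j a (j a x) ≈ j a x
      preserves-⊓ : ∀ {a} (x y : Ω a) → j a (x ⊓ y) ≈ j a x ⊓ j a y

  record Topology : Set where
    field
      op         : Operator
      isTopology : IsTopology op
  open Topology public

searchVec : ∀ {A : Set} → Searchable A → ∀ m → Searchable (Vec A m)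
searchVec s zero    P? = map′ (λ p → [] , p) (λ { ([] , p) → p }) (P? [])
searchVec s (suc m) P? =
  map′ (λ (x , xs , p) → x ∷ xs , p) (λ { (x ∷ xs , p) → x , xs , p })
       (s (λ x → searchVec s m (λ xs → P? (x ∷ xs))))

Monotone : ∀ {k l} → Vec (Fin l) k → Set
Monotone v = ∀ i j → i Fin.≤ j → lookup v i Fin.≤ lookup v j

Injective : ∀ {k l} → Vec (Fin l) k → Set
Injective v = ∀ i j → lookup v i ≡ lookup v j → i ≡ j

infix 4 _⟶_ _↪_

-- Monotone maps {0<…<k} → {0<…<l}.  Maps are stored as their vectors of
-- values, with irrelevant proofs, so that pointwise equal maps are
-- propositionally equal.
record _⟶_ (k l : ℕ) : Set where
  constructor mk
  field
    values    : Vec (Fin (suc l)) (suc k)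
    .monotone : Monotone values
open _⟶_ public

record _↪_ (k l : ℕ) : Set where
  constructor mk
  field
    incl       : k ⟶ l
    .injective : Injective (values incl)
open _↪_ public

infixl 10 _at_
_at_ : ∀ {k l} → k ⟶ l → Fin (suc k) → Fin (suc l)
f at i = lookup (values f) i

at-mono : ∀ {k l} (f : k ⟶ l) {i j} → i Fin.≤ j → f at i Fin.≤ f at j
at-mono f@(mk _ m) {i} {j} i≤j = recompute (f at i ≤ᶠ? f at j) (m i j i≤j)

at-inj : ∀ {k l} (f : k ↪ l) {i j} → incl f at i ≡ incl f at j → i ≡ j
at-inj (mk _ inj) {i} {j} eq = recompute (i ≟ᶠ j) (inj i j eq)

⟶-values : ∀ {k l} {f g : k ⟶ l} → values f ≡ values g → f ≡ g
⟶-values refl = refl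

⟶-ext : ∀ {k l} {f g : k ⟶ l} → (∀ i → f at i ≡ g at i) → f ≡ g
⟶-ext {f = f} {g} eq = ⟶-values (begin
  values f                   ≡⟨ sym (tabulate∘lookup (values f)) ⟩
  tabulate (f at_)           ≡⟨ tabulate-cong eq ⟩
  tabulate (g at_)           ≡⟨ tabulate∘lookup (values g) ⟩
  values g                   ∎)
  where open ≡-Reasoning

↪-incl : ∀ {k l} {f g : k ↪ l} → incl f ≡ incl g → f ≡ g
↪-incl refl = refl

module _ {k l} (f : Fin (suc k) → Fin (suc l)) where

  fromFun : .(∀ i j → i Fin.≤ j → f i Fin.≤ f j) → k ⟶ l
  fromFun mono = mk (tabulate f) (λ i j i≤j →
    subst (Fin._≤ lookup (tabulate f) j) (sym (lookup∘tabulate f i))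
      (subst (f i Fin.≤_) (sym (lookup∘tabulate f j)) (mono i j i≤j)))

  fromFun-at : .(mono : ∀ i j → i Fin.≤ j → f i Fin.≤ f j) → ∀ i → fromFun mono at i ≡ f i
  fromFun-at mono = lookup∘tabulate f

  fromFun₊ : .(∀ i j → i Fin.≤ j → f i Fin.≤ f j) → .(∀ i j → f i ≡ f j → i ≡ j) → k ↪ l
  fromFun₊ mono inj = mk (fromFun mono) (λ i j eq →
    inj i j (trans (sym (lookup∘tabulate f i)) (trans eq (lookup∘tabulate f j))))

infixr 9 _⊙_ _⊙₊_
infix  4 _≟⟶_ _≟↪_

id⟶ : ∀ {k} → k ⟶ k
id⟶ = fromFun id (λ _ _ i≤j → i≤j)

_⊙_ : ∀ {k l m} → l ⟶ m → k ⟶ l → k ⟶ m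
f ⊙ g = fromFun (λ i → f at (g at i)) (λ _ _ i≤j → at-mono f (at-mono g i≤j))

⊙-at : ∀ {k l m} (f : l ⟶ m) (g : k ⟶ l) i → (f ⊙ g) at i ≡ f at (g at i)
⊙-at f g = lookup∘tabulate (λ i → f at (g at i))

id-at : ∀ {k} (i : Fin (suc k)) → id⟶ at i ≡ i
id-at = lookup∘tabulate id

⊙-identityˡ : ∀ {k l} (f : k ⟶ l) → id⟶ ⊙ f ≡ f
⊙-identityˡ f = ⟶-ext (λ i → trans (⊙-at id⟶ f i) (id-at (f at i)))

⊙-identityʳ : ∀ {k l} (f : k ⟶ l) → f ⊙ id⟶ ≡ f
⊙-identityʳ f = ⟶-ext (λ i → trans (⊙-at f id⟶ i) (cong (f at_) (id-at i)))

⊙-assoc : ∀ {k l m p} (f : m ⟶ p) (g : l ⟶ m) (h : k ⟶ l) → (f ⊙ g) ⊙ h ≡ f ⊙ (g ⊙ h)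
⊙-assoc f g h = ⟶-ext λ i → begin
  ((f ⊙ g) ⊙ h) at i   ≡⟨ ⊙-at (f ⊙ g) h i ⟩
  (f ⊙ g) at (h at i)  ≡⟨ ⊙-at f g (h at i) ⟩
  f at (g at (h at i)) ≡⟨ cong (f at_) (sym (⊙-at g h i)) ⟩
  f at ((g ⊙ h) at i)  ≡⟨ sym (⊙-at f (g ⊙ h) i) ⟩
  (f ⊙ (g ⊙ h)) at i   ∎
  where open ≡-Reasoning

id↪ : ∀ {k} → k ↪ k
id↪ = fromFun₊ id (λ _ _ i≤j → i≤j) (λ _ _ eq → eq)

_⊙₊_ : ∀ {k l m} → l ↪ m → k ↪ l → k ↪ m
f ⊙₊ g = mk (incl f ⊙ incl g) (λ i j eq →
  at-inj g (at-inj f (trans (sym (⊙-at (incl f) (incl g) i))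
                            (trans eq (⊙-at (incl f) (incl g) j)))))

monotone? : ∀ {k l} (v : Vec (Fin l) k) → Dec (Monotone v)
monotone? v = all? λ i → all? λ j → (i ≤ᶠ? j) →-dec (lookup v i ≤ᶠ? lookup v j)

injective? : ∀ {k l} (v : Vec (Fin l) k) → Dec (Injective v)
injective? v = all? λ i → all? λ j → (lookup v i ≟ᶠ lookup v j) →-dec (i ≟ᶠ j)

_≟⟶_ : ∀ {k l} (f g : k ⟶ l) → Dec (f ≡ g)
f ≟⟶ g = map′ ⟶-values (cong values) (≡-dec _≟ᶠ_ (values f) (values g))

_≟↪_ : ∀ {k l} (f g : k ↪ l) → Dec (f ≡ g)
f ≟↪ g = map′ ↪-incl (cong incl) (incl f ≟⟶ incl g)

Σ-dec : ∀ {A : Set} {B : A → Set} → Dec A → (∀ a → Dec (B a)) →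
        (∀ a a′ → B a → B a′) → Dec (Σ A B)
Σ-dec (no ¬a) b? _ = no (λ (a , _) → ¬a a)
Σ-dec (yes a) b? t = map′ (λ b → a , b) (λ (a′ , b) → t a′ a b) (b? a)

search⟶ : ∀ {k l} → Searchable (k ⟶ l)
search⟶ {k} {l} {P} P? =
  map′ (λ (v , m , p) → mk v m , p) (λ { (mk v m , p) → v , recompute (monotone? v) m , p })
       (searchVec any? (suc k) (λ v →
         Σ-dec {B = λ m → P (mk v m)} (monotone? v) (λ m → P? (mk v m)) (λ _ _ p → p)))

search↪ : ∀ {k l} → Searchable (k ↪ l)
search↪ {P = P} P? =
  map′ (λ (f , i , p) → mk f i , p) (λ { (mk f i , p) → f , recompute (injective? (values f)) i , p })
       (search⟶ (λ f →
         Σ-dec {B = λ i → P (mk f i)} (injective? (values f)) (λ i → P? (mk f i)) (λ _ _ p → p)))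

-- δ i is the injection omitting i, and σ i the surjection hitting i
-- twice; their opposites are dᵢ and sᵢ.
δ : ∀ {k} → Fin (suc (suc k)) → k ↪ suc k
δ i = fromFun₊ (punchIn i) (punchIn-mono-≤ i) (punchIn-injective i)

σ : ∀ {k} → Fin (suc k) → suc k ⟶ k
σ i = fromFun (pinch i) (λ _ _ → pinch-mono-≤ i)

record Ob (n : ℕ) : Set where
  constructor ob
  field
    dim    : ℕ
    .bound : dim ≤ n
open Ob public

searchOb : ∀ {n} → Searchable (Ob n)
searchOb {n} {P} P? =
  map′ (λ (i , p) → toOb i , p) (λ (a , p) → fromOb a , subst′ a p) (any? (λ i → P? (toOb i)))
  where
  toOb : Fin (suc n) → Ob n
  toOb i = ob (toℕ i) (≤-pred (toℕ<n i))
  fromOb : Ob n → Fin (suc n)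
  fromOb (ob k b) = fromℕ< {k} (s≤s b)
  ob-≡ : ∀ {k l} .{p : k ≤ n} .{q : l ≤ n} → k ≡ l → ob k p ≡ ob l q
  ob-≡ refl = refl
  subst′ : ∀ a → P a → P (toOb (fromOb a))
  subst′ (ob k p) = subst P (ob-≡ (sym (toℕ-fromℕ< (s≤s p))))

Δ≤ : ℕ → FinCat
Δ≤ n = record
  { Obj       = Ob n
  ; _⇒_       = λ a b → dim a ⟶ dim b
  ; idn       = id⟶
  ; _∘_       = _⊙_
  ; identityˡ = ⊙-identityˡ
  ; identityʳ = ⊙-identityʳ
  ; assoc     = ⊙-assoc
  ; searchObj = searchOb
  ; searchHom = search⟶
  }

Δ₊≤ : ℕ → FinCat
Δ₊≤ n = record
  { Obj       = Ob n
  ; _⇒_       = λ a b → dim a ↪ dim b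
  ; idn       = id↪
  ; _∘_       = _⊙₊_
  ; identityˡ = λ f → ↪-incl (⊙-identityˡ (incl f))
  ; identityʳ = λ f → ↪-incl (⊙-identityʳ (incl f))
  ; assoc     = λ f g h → ↪-incl (⊙-assoc (incl f) (incl g) (incl h))
  ; searchObj = searchOb
  ; searchHom = search↪
  }

σδ : ∀ {l} (i : Fin (suc l)) (j : Fin (suc (suc l))) →
     punchIn (inject₁ i) (pinch i j) ≡ j ⊎ (j ≡ inject₁ i × punchIn (inject₁ i) (pinch i j) ≡ suc i)
σδ zero    zero    = inj₂ (refl , refl)
σδ zero    (suc j) = inj₁ refl
σδ (suc i) zero    = inj₁ refl
σδ {suc l} (suc i) (suc j) with σδ i j
... | inj₁ e        = inj₁ (cong suc e)
... | inj₂ (e , e′) = inj₂ (cong suc e , cong suc e′)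

pinch-repeat : ∀ {l} (i : Fin (suc l)) → pinch i (inject₁ i) ≡ pinch i (suc i)
pinch-repeat zero            = refl
pinch-repeat {suc l} (suc i) = cong suc (pinch-repeat i)

Repeat : ∀ {l k} → suc l ⟶ k → Fin (suc l) → Set
Repeat e i = e at (inject₁ i) ≡ e at (suc i)

factor-σ : ∀ {l k} (e : suc l ⟶ k) i → Repeat e i → e ≡ (e ⊙ incl (δ (inject₁ i))) ⊙ σ i
factor-σ e i r = ⟶-ext λ j → sym (begin
  ((e ⊙ incl d) ⊙ σ i) at j       ≡⟨ ⊙-at (e ⊙ incl d) (σ i) j ⟩
  (e ⊙ incl d) at (σ i at j)      ≡⟨ ⊙-at e (incl d) (σ i at j) ⟩
  e at (incl d at (σ i at j))     ≡⟨ cong (e at_) (lookup∘tabulate (punchIn (inject₁ i)) (σ i at j)) ⟩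
  e at punchIn (inject₁ i) (σ i at j)
                                  ≡⟨ cong (λ z → e at punchIn (inject₁ i) z) (lookup∘tabulate (pinch i) j) ⟩
  e at punchIn (inject₁ i) (pinch i j)
                                  ≡⟨ pointwise j ⟩
  e at j                          ∎)
  where
  open ≡-Reasoning
  d = δ (inject₁ i)
  pointwise : ∀ j → e at punchIn (inject₁ i) (pinch i j) ≡ e at j
  pointwise j with σδ i j
  ... | inj₁ eq          = cong (e at_) eq
  ... | inj₂ (eq , eq′) = trans (cong (e at_) eq′) (trans (sym r) (cong (e at_) (sym eq)))

σ-repeat : ∀ {l k} (f : l ⟶ k) i → Repeat (f ⊙ σ i) i
σ-repeat f i = begin
  (f ⊙ σ i) at inject₁ i  ≡⟨ ⊙-at f (σ i) (inject₁ i) ⟩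
  f at (σ i at inject₁ i) ≡⟨ cong (f at_) σ-eq ⟩
  f at (σ i at suc i)     ≡⟨ sym (⊙-at f (σ i) (suc i)) ⟩
  (f ⊙ σ i) at suc i      ∎
  where
  open ≡-Reasoning
  σ-eq : σ i at inject₁ i ≡ σ i at suc i
  σ-eq = trans (lookup∘tabulate (pinch i) (inject₁ i))
               (trans (pinch-repeat i) (sym (lookup∘tabulate (pinch i) (suc i))))

inject₁≢suc : ∀ {m} (i : Fin m) → inject₁ i ≢ suc i
inject₁≢suc (suc i) eq = inject₁≢suc i (suc-injective eq)

¬repeat⇒injective : ∀ {l k} (e : suc l ⟶ k) → (∀ i → ¬ Repeat e i) → Injective (values e)
¬repeat⇒injective e ¬r i j eq = go i j eq
  where
  strict : ∀ i j → i Fin.< j → e at i ≢ e at j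
  strict i j i<j eq = ¬r i′ (≤ᶠ-antisym (at-mono e inject≤suc)
      (subst (e at suc i′ Fin.≤_) (trans (sym eq) (cong (e at_) i≡)) (at-mono e suc≤j)))
    where
    i<sl : toℕ i ℕ.< suc _
    i<sl = <-≤-trans i<j (≤-pred (toℕ<n j))
    i′ = fromℕ< i<sl
    i≡ : i ≡ inject₁ i′
    i≡ = toℕ-injective (sym (trans (toℕ-inject₁ i′) (toℕ-fromℕ< i<sl)))
    inject≤suc : inject₁ i′ Fin.≤ suc i′
    inject≤suc = ≤-trans (≤-reflexive (toℕ-inject₁ i′)) (n≤1+n _)
    suc≤j : suc i′ Fin.≤ j
    suc≤j = ≤-trans (≤-reflexive (cong suc (toℕ-fromℕ< i<sl))) i<j
  go : ∀ i j → e at i ≡ e at j → i ≡ j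
  go i j eq with <-cmp i j
  ... | tri< i<j _ _ = contradiction eq (strict i j i<j)
  ... | tri≈ _ i≡j _ = i≡j
  ... | tri> _ _ j<i = contradiction (sym eq) (strict j i j<i)

injective⊎repeat : ∀ {l k} (e : suc l ⟶ k) → Injective (values e) ⊎ ∃ (Repeat e)
injective⊎repeat e with any? (λ i → e at inject₁ i ≟ᶠ e at suc i)
... | yes r = inj₂ r
... | no ¬r = inj₁ (¬repeat⇒injective e (λ i r → ¬r (i , r)))

module _ {n : ℕ} where

  private
    module C  = Classifier (Δ≤ n)
    module C₊ = Classifier (Δ₊≤ n)

  -- A family of subsets of the sets of all monotone maps l → k.
  Simplices : ℕ → Set₁
  Simplices k = ∀ l → .(l ≤ n) → l ⟶ k → Set

  degen : ∀ {k} → Simplices k → Simplices k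
  degen X zero    _ g = ⊥
  degen X (suc l) b g =
    ∃[ i ] ∃[ f ] (X l (<⇒≤ b) f ⊎ degen X l (<⇒≤ b) f) × g ≡ f ⊙ σ i

  degen? : ∀ {k} {X : Simplices k} → (∀ l .(b : l ≤ n) f → Dec (X l b f)) →
           ∀ l .(b : l ≤ n) g → Dec (degen X l b g)
  degen? X? zero    b g = no (λ ())
  degen? X? (suc l) b g = any? λ i → search⟶ λ f →
    (X? l (<⇒≤ b) f ⊎-dec degen? X? l (<⇒≤ b) f) ×-dec (g ≟⟶ f ⊙ σ i)

  simplices : ∀ {k} → C.Ω k → Simplices (dim k)
  simplices x l b f = C._∈_ {b = ob l b} f x

  simplices? : ∀ {k} (x : C.Ω k) l .(b : l ≤ n) f → Dec (simplices x l b f)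
  simplices? x l b f = T? _

  simplices₊ : ∀ {k} → C₊.Ω k → Simplices (dim k)
  simplices₊ x l b f = ∃[ u ] incl u ≡ f × C₊._∈_ {b = ob l b} u x

  simplices₊? : ∀ {k} (x : C₊.Ω k) l .(b : l ≤ n) f → Dec (simplices₊ x l b f)
  simplices₊? x l b f = search↪ λ u → (incl u ≟⟶ f) ×-dec T? _

  InF : ∀ {k} → C₊.Ω k → Simplices (dim k)
  InF x l b f = simplices₊ x l b f ⊎ degen (simplices₊ x) l b f

  Factored : ∀ {k} → C₊.Ω k → Simplices (dim k)
  Factored x l b f = ∃[ p ] ∃[ u ] Σ[ e ∈ l ⟶ dim p ] C₊._∈_ {b = p} u x × f ≡ incl u ⊙ e

  toFactored : ∀ {k} (x : C₊.Ω k) l .(b : l ≤ n) f → InF x l b f → Factored x l b f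
  toFactored x l b f (inj₁ (u , refl , u∈x)) =
    ob l b , u , id⟶ , u∈x , sym (⊙-identityʳ (incl u))
  toFactored x (suc l) b g (inj₂ (i , f , f∈ , refl))
    with toFactored x l (<⇒≤ b) f f∈
  ... | p , u , e , u∈x , refl = p , u , e ⊙ σ i , u∈x , ⊙-assoc (incl u) e (σ i)

  fromInjective : ∀ {k} (x : C₊.Ω k) p l .(b : l ≤ n) u (e : l ⟶ dim p) →
                  C₊._∈_ {b = p} u x → Injective (values e) → InF x l b (incl u ⊙ e)
  fromInjective x p l b u e u∈x inj =
    inj₁ (u ⊙₊ mk e inj , refl , C₊.closed x {b = p} {c = ob l b} u (mk e inj) u∈x)

  fromFactored : ∀ {k} (x : C₊.Ω k) p l .(b : l ≤ n) u (e : l ⟶ dim p) →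
                 C₊._∈_ {b = p} u x → InF x l b (incl u ⊙ e)
  fromFactored x p zero b u e u∈x = fromInjective x p zero b u e u∈x (λ { zero zero _ → refl })
  fromFactored x p (suc l) b u e u∈x with injective⊎repeat e
  ... | inj₁ inj     = fromInjective x p (suc l) b u e u∈x inj
  ... | inj₂ (i , r) = inj₂ (i , incl u ⊙ e′ , fromFactored x p l (<⇒≤ b) u e′ u∈x , eq)
    where
    e′ = e ⊙ incl (δ (inject₁ i))
    eq : incl u ⊙ e ≡ (incl u ⊙ e′) ⊙ σ i
    eq = trans (cong (incl u ⊙_) (factor-σ e i r)) (sym (⊙-assoc (incl u) e′ (σ i)))

  InF-closed : ∀ {k} (x : C₊.Ω k) l m .(b : l ≤ n) .(c : m ≤ n) f (g : m ⟶ l) →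
               InF x l b f → InF x m c (f ⊙ g)
  InF-closed x l m b c f g f∈ with toFactored x l b f f∈
  ... | p , u , e , u∈x , refl =
    subst (InF x m c) (sym (⊙-assoc (incl u) e g)) (fromFactored x p m c u (e ⊙ g) u∈x)

  degen-not-injective : ∀ {k} {X : Simplices k} l .(b : l ≤ n) (f : l ↪ k) →
                        ¬ degen X l b (incl f)
  degen-not-injective (suc l) b f (i , g , _ , eq) =
    inject₁≢suc i (at-inj f (subst (λ h → Repeat h i) (sym eq) (σ-repeat g i)))

  F : ∀ k → C₊.Ω k → C.Ω k
  F k x = C.comprehension
    {P = λ { {ob l b} f → simplices₊ x l b f ⊎ degen (simplices₊ x) l b f }}
    (λ { {ob l b} f → simplices₊? x l b f ⊎-dec degen? (simplices₊? x) l b f })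
    (λ { {ob l b} {ob m c} f g → InF-closed x l m b c f g })

  -- x(l) ∖ degen(x,l) consists of injective maps: a non-injective g ∈ x(l)
  -- is (g ⊙ δ i) ⊙ σ i for some i.  So restricting membership to injective
  -- maps loses nothing.
  F⁻¹ : ∀ k → C.Ω k → C₊.Ω k
  F⁻¹ k x = C₊.comprehension
    {P = λ { {ob l b} f → simplices x l b (incl f) × ¬ degen (simplices x) l b (incl f) }}
    (λ { {ob l b} f → simplices? x l b (incl f) ×-dec ¬? (degen? (simplices? x) l b (incl f)) })
    (λ { {ob l b} {ob m c} f g (f∈x , _) →
         C.closed x {b = ob l b} {c = ob m c} (incl f) (incl g) f∈x
         , degen-not-injective m c (f ⊙₊ g) })

  ∖degen-injective : ∀ {k} (x : C.Ω k) l .(b : l ≤ n) f → simplices x l b f →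
                     ¬ degen (simplices x) l b f → Injective (values f)
  ∖degen-injective x zero    b f f∈x f∉ = λ { zero zero _ → refl }
  ∖degen-injective x (suc l) b f f∈x f∉ with injective⊎repeat f
  ... | inj₁ inj     = inj
  ... | inj₂ (i , r) = contradiction
    (i , f ⊙ incl (δ (inject₁ i)) ,
     inj₁ (C.closed x {b = ob (suc l) b} {c = ob l (<⇒≤ b)} f (incl (δ (inject₁ i))) f∈x) ,
     factor-σ f i r) f∉

  F⁻¹∘_∘F : C.Operator → C₊.Operator
  (F⁻¹∘ j ∘F) k x = F⁻¹ k (j k (F k x))

module _ {n : ℕ} where

  private
    module C₊ = Classifier (Δ₊≤ n)

  open C₊ using (_≈_; _≈?_; ⊤; Ω[_])

  below : ∀ {k} → .(suc k ≤ n) → Ob n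
  below {k} b = ob k (<⇒≤ b)

  -- The i-th face of y₊(k+1) consists of the maps that factor through δ i.
  InBoundary : ∀ {k l} → l ↪ suc k → Set
  InBoundary {k} {l} f = ∃[ i ] Σ[ g ∈ l ↪ k ] f ≡ δ i ⊙₊ g

  inBoundary? : ∀ {k l} (f : l ↪ suc k) → Dec (InBoundary f)
  inBoundary? f = any? λ i → search↪ λ g → f ≟↪ δ i ⊙₊ g

  boundary : ∀ a → C₊.Ω a
  boundary (ob zero    b) = C₊.comprehension {P = λ _ → ⊥} (λ _ → no id) (λ _ _ ())
  boundary (ob (suc k) b) = C₊.comprehension
    {P = InBoundary}
    inBoundary?
    (λ { f h (i , g , refl) → i , g ⊙₊ h , ↪-incl (⊙-assoc (incl (δ i)) (incl g) (incl h)) })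

  -- Incidence tuples are indexed by the face: entry i is Ω₊(dᵢ)(x).
  Tuple : ∀ {k} → .(suc k ≤ n) → Set
  Tuple {k} b = Fin (suc (suc k)) → C₊.Ω (below b)

  incidence : ∀ {k} .(b : suc k ≤ n) → C₊.Ω (ob (suc k) b) → Tuple b
  incidence b x i = Ω[_] {a = below b} {b = ob _ b} (δ i) x

  -- Membership in the union of the images of the z i along the faces.
  Spanned : ∀ {k} .(b : suc k ≤ n) → Tuple b → ∀ l → dim l ↪ suc k → Set
  Spanned {k} b z l f = ∃[ i ] Σ[ g ∈ dim l ↪ k ] C₊._∈_ {b = l} g (z i) × f ≡ δ i ⊙₊ g

  spanned? : ∀ {k} .(b : suc k ≤ n) (z : Tuple b) l f → Dec (Spanned b z l f)
  spanned? b z l f = any? λ i → search↪ λ g → T? (C₊.mem (z i) {l} g) ×-dec (f ≟↪ δ i ⊙₊ g)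

  spanned-closed : ∀ {k} .(b : suc k ≤ n) (z : Tuple b) l m f (h : dim m ↪ dim l) →
                   Spanned b z l f → Spanned b z m (f ⊙₊ h)
  spanned-closed b z l m f h (i , g , g∈ , refl) =
    i , g ⊙₊ h , C₊.closed (z i) {b = l} {c = m} g h g∈ ,
    ↪-incl (⊙-assoc (incl (δ i)) (incl g) (incl h))

  withIncidence : ∀ {k} .(b : suc k ≤ n) → Tuple b → C₊.Ω (ob (suc k) b)
  withIncidence b z = C₊.comprehension
    {P = λ {l} f → Spanned b z l f}
    (λ {l} f → spanned? b z l f)
    (λ {l} {m} f h → spanned-closed b z l m f h)

  T-ext : ∀ {p q} → (T p → T q) → (T q → T p) → p ≡ q
  T-ext {false} {false} _ _ = refl
  T-ext {false} {true}  _ g = ⊥-elim (g tt)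
  T-ext {true}  {false} f _ = ⊥-elim (f tt)
  T-ext {true}  {true}  _ _ = refl

  factor-δ : ∀ {l k} (f : l ↪ suc k) i → (∀ j → i ≢ incl f at j) → ∃[ g ] f ≡ δ i ⊙₊ g
  factor-δ {l} {k} f i i∉ = g , ↪-incl (⟶-ext λ j → sym (begin
    (incl (δ i) ⊙ incl g) at j      ≡⟨ ⊙-at (incl (δ i)) (incl g) j ⟩
    incl (δ i) at (incl g at j)     ≡⟨ lookup∘tabulate (punchIn i) _ ⟩
    punchIn i (incl g at j)         ≡⟨ cong (punchIn i) (lookup∘tabulate (λ j → punchOut (i∉ j)) j) ⟩
    punchIn i (punchOut (i∉ j))     ≡⟨ punchIn-punchOut (i∉ j) ⟩
    incl f at j                     ∎))
    where
    open ≡-Reasoning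
    g : l ↪ k
    g = fromFun₊ (λ j → punchOut (i∉ j))
      (λ j j′ j≤j′ → punchOut-mono-≤ (i∉ j) (i∉ j′) (at-mono (incl f) j≤j′))
      (λ j j′ eq → at-inj f (punchOut-injective (i∉ j) (i∉ j′) eq))

  section : ∀ {l k} (f : l ↪ k) → (∀ i → ∃[ j ] i ≡ incl f at j) → ∃[ s ] f ⊙₊ s ≡ id↪
  section {l} {k} f surj = s , ↪-incl (⟶-ext λ i → begin
    (incl f ⊙ incl s) at i  ≡⟨ ⊙-at (incl f) (incl s) i ⟩
    incl f at (incl s at i) ≡⟨ cong (incl f at_) (lookup∘tabulate (λ i → proj₁ (surj i)) i) ⟩
    incl f at proj₁ (surj i) ≡⟨ sym (proj₂ (surj i)) ⟩
    i                       ≡⟨ sym (id-at i) ⟩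
    id⟶ at i                ∎)
    where
    open ≡-Reasoning
    inv : Fin (suc k) → Fin (suc l)
    inv i = proj₁ (surj i)
    inv-inj : ∀ i j → inv i ≡ inv j → i ≡ j
    inv-inj i j eq = trans (proj₂ (surj i)) (trans (cong (incl f at_) eq) (sym (proj₂ (surj j))))
    inv-mono : ∀ i j → i Fin.≤ j → inv i Fin.≤ inv j
    inv-mono i j i≤j with ≤ᶠ-total (inv i) (inv j)
    ... | inj₁ le = le
    ... | inj₂ ge = subst (λ z → inv i Fin.≤ inv z) i≡j ≤ᶠ-refl
      where
      j≤i : j Fin.≤ i
      j≤i = subst₂ Fin._≤_ (sym (proj₂ (surj j))) (sym (proj₂ (surj i))) (at-mono (incl f) ge)
      i≡j : i ≡ j
      i≡j = ≤ᶠ-antisym i≤j j≤i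
    s : k ↪ l
    s = fromFun₊ inv inv-mono inv-inj

  module _ {k} .(b : suc k ≤ n) (z : Tuple b) (y : C₊.Ω (ob (suc k) b))
           (y~z : ∀ i → incidence b y i ≈ z i) where

    topOb : Ob n
    topOb = ob (suc k) b

    id∈⇒⊤ : C₊._∈_ {b = topOb} id↪ y → ∀ i → z i ≈ ⊤
    id∈⇒⊤ id∈y i {m} g = trans (sym (y~z i {m} g)) (Equivalence.to T-≡
      (subst (λ h → T (C₊.mem y {m} h)) (↪-incl (⊙-identityˡ (incl (δ i ⊙₊ g))))
        (C₊.closed y {b = topOb} {c = m} id↪ (δ i ⊙₊ g) id∈y)))

    ∈⇒spanned : ¬ (∀ i → z i ≈ ⊤) → ∀ l f → C₊._∈_ {b = l} f y → Spanned b z l f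
    ∈⇒spanned z≉⊤ l f f∈y = case any? (λ i → all? (λ j → ¬? (i ≟ᶠ incl f at j))) of λ where
        (yes (i , i∉)) → let (g , eq) = factor-δ f i i∉ in
          i , g , subst T (trans (cong (C₊.mem y {l}) eq) (y~z i {l} g)) f∈y , eq
        (no ¬i) → ⊥-elim (z≉⊤ (id∈⇒⊤ (id∈y ¬i)))
      where
      module _ (¬i : ¬ (∃[ i ] ∀ j → i ≢ incl f at j)) where
        surj : ∀ i → ∃[ j ] i ≡ incl f at j
        surj i = decidable-stable (any? (λ j → i ≟ᶠ incl f at j))
                   (λ ¬j → ¬i (i , λ j eq → ¬j (j , eq)))
        id∈y : C₊._∈_ {b = topOb} id↪ y
        id∈y = let (s , eq) = section f surj in
          subst (λ h → T (C₊.mem y {topOb} h)) eq (C₊.closed y {b = l} {c = topOb} f s f∈y)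

    spanned⇒∈ : ∀ l f → Spanned b z l f → C₊._∈_ {b = l} f y
    spanned⇒∈ l f (i , g , g∈ , refl) = subst T (sym (y~z i {l} g)) g∈

  -- If z is not constantly ⊤ and some element has incidence tuple z, then
  -- that element is unique, and it is withIncidence z.
  withIncidence-unique :
    ∀ {k} .(b : suc k ≤ n) (z : Tuple b) (y : C₊.Ω (ob (suc k) b)) →
    (∀ i → incidence b y i ≈ z i) → ¬ (∀ i → z i ≈ ⊤) → y ≈ withIncidence b z
  withIncidence-unique b z y y~z z≉⊤ {l} f =
    T-ext (λ f∈y → fromWitness {a? = spanned? b z l f} (∈⇒spanned b z y y~z z≉⊤ l f f∈y))
          (λ f∈ → spanned⇒∈ b z y y~z l f (toWitness {a? = spanned? b z l f} f∈))

  -- A word in {0,1}ⁿ⁺¹ has false for 0 and true for 1.  Appending a bit to w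
  -- leaves j^w unchanged in the old dimensions, so (j^w)ₖ is a recursion on k
  -- in which dimension k consults the k-th bit.
  bit : Vec Bool (suc n) → ∀ k → .(k ≤ n) → Bool
  bit w k b = lookup w (fromℕ< {k} (s≤s b))

  level : Vec Bool (suc n) → ∀ k .(b : k ≤ n) → C₊.Ω (ob k b) → C₊.Ω (ob k b)
  level w zero    b x = if bit w zero b then ⊤ else x
  level w (suc k) b x =
    if ⌊ x ≈? ⊤ ⌋ then ⊤
    else if ⌊ x ≈? boundary a ⌋ then filled
    else if ⌊ all? (λ i → z i ≈? ⊤) ⌋ then filled
    else withIncidence b z
    where
    a = ob (suc k) b
    filled : C₊.Ω a
    filled = if bit w (suc k) b then ⊤ else boundary a
    z : Tuple b
    z i = level w k (<⇒≤ b) (incidence b x i)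

  j^_ : Vec Bool (suc n) → C₊.Operator
  (j^ w) (ob k b) = level w k b

-- w = 0ᵐ1ⁿ⁺¹⁻ᵐ for some 0 ≤ m ≤ n + 1.
ZerosThenOnes : ∀ {n} → Vec Bool (suc n) → Set
ZerosThenOnes {n} w =
  ∃[ m ] m ≤ suc n × toList w ≡ replicate m false ++ replicate (suc n ∸ m) true

module S  (n : ℕ) = Classifier (Δ≤ n)
module S₊ (n : ℕ) = Classifier (Δ₊≤ n)

infix 4 _≋_ _≋₊_ _≋ₛ_

_≋_ : ∀ {n} → S.Topology n → S.Topology n → Set
_≋_ {n} j j′ = S._≋_ n (S.op j) (S.op j′)

_≋₊_ : ∀ {n} → S₊.Operator n → S₊.Operator n → Set
_≋₊_ {n} = S₊._≋_ n

-- The set { j^w | j^w is a topology and w = 0ᵐ1ⁿ⁺¹⁻ᵐ for some m }.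
SortedTopology : ℕ → Set
SortedTopology n = Σ[ t ∈ S₊.Topology n ] ∃[ w ] ZerosThenOnes w × S₊.op t ≋₊ (j^ w)

_≋ₛ_ : ∀ {n} → SortedTopology n → SortedTopology n → Set
(t , _) ≋ₛ (t′ , _) = S₊.op t ≋₊ S₊.op t′

F⁻¹-F : ∀ {n} →
  (∀ (j : S.Topology n) → S₊.IsTopology n (F⁻¹∘ S.op j ∘F)) →
  (∀ (j : S.Topology n) → ∃[ w ] ZerosThenOnes w × (F⁻¹∘ S.op j ∘F) ≋₊ (j^ w)) →
  S.Topology n → SortedTopology n
F⁻¹-F isTop sorted j = record { op = F⁻¹∘ S.op j ∘F ; isTopology = isTop j } , sorted j

{-# OPTIONS --safe #-}
module Submission where

-- Every topology in question is rigid: for a set D of objects, f belongs to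
-- j(x) iff f ∘ g ∈ x for all g out of objects in D.  Here D consists of the k
-- whose boundary ∂y(k) does not cover y(k), because a sieve without the
-- identity lies in the boundary, and covering can be checked by induction along
-- the faces.  On the semisimplicial side every D occurs, and D is the set of
-- zeros of w.  On the simplicial side k is a retract of every l ≥ k, so D is
-- downward closed, that is w = 0ᵐ1ⁿ⁺¹⁻ᵐ; for such D, factoring monotone maps as
-- an injection after a surjection shows that F⁻¹ j F is rigid for the same D.

open import Defs
open import Data.Bool using (Bool; true; false; T; not; _∧_; _∨_; if_then_else_)
open import Data.Bool.Properties using (T-∧; T-≡; T?) renaming (_≟_ to _≟ᵇ_)
open import Data.Fin as Fin using (Fin; zero; suc; toℕ; fromℕ<; inject₁; punchIn; punchOut; pinch)
open import Data.Fin.Properties using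
  ( any?; all?; injective⇒≤; punchIn-mono-≤; punchInᵢ≢i; punchIn-punchOut; punchOut-mono-≤; pinch-mono-≤
  ; toℕ<n; toℕ-fromℕ<; fromℕ<-toℕ)
  renaming (_≟_ to _≟ᶠ_; ≤-antisym to ≤ᶠ-antisym; ≤-refl to ≤ᶠ-refl; ≤-total to ≤ᶠ-total)
open import Data.List using (_++_; replicate) renaming (_∷_ to _∷ˡ_)
open import Data.List.Properties using (∷-injective)
open import Data.Nat using (ℕ; zero; suc; _∸_; _≤_; _<_; z≤n; s≤s; _≤′_; ≤′-refl; ≤′-step)
open import Data.Nat.Induction using (<-wellFounded)
open import Data.Nat.Properties using (≤-pred; ≤-refl; ≤-trans; n≤1+n; ≤-antisym; ≤⇒≤′; <⇒≤)
open import Data.Product using (∃; Σ-syntax; ∃-syntax; _×_; _,_; proj₁; proj₂)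
open import Data.Sum using (_⊎_; inj₁; inj₂; fromInj₂)
open import Data.Unit using (tt)
open import Data.Vec using (Vec; []; _∷_; lookup; tabulate; toList)
open import Data.Vec.Properties using (lookup∘tabulate)
open import Function using (_⇔_; mk⇔; case_of_; module Equivalence)
open import Function.Structures using (IsBijection)
open import Induction.WellFounded using (Acc; acc)
open import Relation.Binary.Structures using (IsEquivalence)
import Relation.Binary.Construct.On as On
open import Relation.Binary.PropositionalEquality
  using (_≡_; _≢_; refl; sym; trans; cong; cong₂; subst; subst₂)
open import Relation.Nullary using (¬_; Dec; yes; no; Reflects; ofʸ; ofⁿ; does; _because_; contradiction)
open import Relation.Nullary.Decidable
  using (⌊_⌋; map′; ¬?; _×-dec_; _⊎-dec_; toWitness; fromWitness; decidable-stable)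

-- Sieves and rigid topologies on a finite category.

module Sieves (C : FinCat) where
  open FinCat C
  open Classifier C renaming (_≋_ to _≋ᵒ_)

  infix 4 _⊑_
  _⊑_ : ∀ {a} → Ω a → Ω a → Set
  x ⊑ y = ∀ {b} (f : b ⇒ _) → f ∈ x → f ∈ y

  ⊑-antisym : ∀ {a} {x y : Ω a} → x ⊑ y → y ⊑ x → x ≈ y
  ⊑-antisym p q f = T-ext {0} (p f) (q f)

  ≈⇒⊑ : ∀ {a} {x y : Ω a} → x ≈ y → x ⊑ y
  ≈⇒⊑ e f = subst T (e f)

  id∈⇒∈ : ∀ {a b} (x : Ω a) → idn ∈ x → (f : b ⇒ a) → f ∈ x
  id∈⇒∈ x i f = subst (_∈ x) (identityˡ f) (closed x idn f i)

  id∈⇒≈⊤ : ∀ {a} (x : Ω a) → idn ∈ x → x ≈ ⊤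
  id∈⇒≈⊤ x i f = Equivalence.to T-≡ (id∈⇒∈ x i f)

  ≋-sym : ∀ {j j′ : Operator} → j ≋ᵒ j′ → j′ ≋ᵒ j
  ≋-sym e a x f = sym (e a x f)

  ≋-trans : ∀ {j j′ j″ : Operator} → j ≋ᵒ j′ → j′ ≋ᵒ j″ → j ≋ᵒ j″
  ≋-trans e e′ a x f = trans (e a x f) (e′ a x f)

  ≋-isEquivalence : IsEquivalence _≋ᵒ_
  ≋-isEquivalence = record
    { refl  = λ a x f → refl
    ; sym   = λ {j} {j′} → ≋-sym {j} {j′}
    ; trans = λ {j} {j′} {j″} → ≋-trans {j} {j′} {j″}
    }

  transport-isTopology : ∀ {j j′ : Operator} → j ≋ᵒ j′ → IsTopology j → IsTopology j′
  transport-isTopology {j} {j′} e t = record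
    { cong-≈      = λ {a} {x} {y} p f → trans (sym (e a x f)) (trans (cong-≈ p f) (e a y f))
    ; natural     = λ {a} {b} g x f →
        trans (sym (e a (Ω[ g ] x) f)) (trans (natural g x f) (e b x (g ∘ f)))
    ; preserves-⊤ = λ {a} f → trans (sym (e a ⊤ f)) (preserves-⊤ f)
    ; idempotent  = λ {a} x f →
        trans (sym (e a (j′ a x) f))
          (trans (cong-≈ (λ g → sym (e a x g)) f) (trans (idempotent x f) (e a x f)))
    ; preserves-⊓ = λ {a} x y f →
        trans (sym (e a (x ⊓ y) f)) (trans (preserves-⊓ x y f) (cong₂ _∧_ (e a x f) (e a y f)))
    }
    where open IsTopology t

  -- The set D is encoded by the objects that `β` sends to `false`, so that the bits of a word,
  -- whose zeros mark D, can serve as `β`.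
  Detected : (Obj → Bool) → ∀ {a b} → Ω a → b ⇒ a → Set
  Detected β {b = b} x f = ∀ d → β d ≡ false → (g : d ⇒ b) → f ∘ g ∈ x

  detected? : ∀ β {a b} (x : Ω a) (f : b ⇒ a) → Dec (Detected β x f)
  detected? β x f =
    -- Search decides existence only, so the universal statement is decided as the absence of a
    -- counterexample.
    map′ (λ ¬p d β≡ g → decidable-stable (T? _) (λ ∉ → ¬p (d , g , β≡ , ∉)))
         (λ p (d , g , β≡ , ∉) → ∉ (p d β≡ g))
         (¬? (searchObj λ d → searchHom λ g → (β d ≟ᵇ false) ×-dec ¬? (T? (mem x (f ∘ g)))))

  -- Without opacity, conversion checking unfolds the exhaustive searches in
  -- detected? and does not finish in reasonable time.
  opaque

    -- The topology whose sheaves are determined by their values on the objects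
    -- d with β d ≡ false.
    rigid : (Obj → Bool) → Operator
    rigid β a x = comprehension {P = Detected β x} (detected? β x)
      (λ f g p d β≡ h → subst (_∈ x) (sym (assoc f g h)) (p d β≡ (g ∘ h)))

    ∈rigid⇒ : ∀ β {a b} (x : Ω a) (f : b ⇒ a) → f ∈ rigid β a x → Detected β x f
    ∈rigid⇒ β x f = toWitness {a? = detected? β x f}

    ⇒∈rigid : ∀ β {a b} (x : Ω a) (f : b ⇒ a) → Detected β x f → f ∈ rigid β a x
    ⇒∈rigid β x f = fromWitness {a? = detected? β x f}

  ⊑rigid : ∀ β {a} (x : Ω a) → x ⊑ rigid β a x
  ⊑rigid β x f f∈ = ⇒∈rigid β x f λ _ _ g → closed x f g f∈

  rigid-mono : ∀ β {a} {x y : Ω a} → x ⊑ y → rigid β a x ⊑ rigid β a y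
  rigid-mono β {x = x} {y} p f f∈ =
    ⇒∈rigid β y f λ d β≡ g → p (f ∘ g) (∈rigid⇒ β x f f∈ d β≡ g)

  rigid-cong : ∀ {β β′} → (∀ d → β d ≡ β′ d) → rigid β ≋ᵒ rigid β′
  rigid-cong {β} {β′} e a x f = T-ext {0}
    (λ p → ⇒∈rigid β′ x f λ d β≡ → ∈rigid⇒ β x f p d (trans (e d) β≡))
    (λ p → ⇒∈rigid β x f λ d β≡ → ∈rigid⇒ β′ x f p d (trans (sym (e d)) β≡))

  rigid-isTopology : ∀ β → IsTopology (rigid β)
  rigid-isTopology β = record
    { cong-≈      = λ {a} {x} {y} e → ⊑-antisym {x = rigid β a x} {rigid β a y}
        (rigid-mono β {x = x} {y} (≈⇒⊑ {x = x} {y} e))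
        (rigid-mono β {x = y} {x} (≈⇒⊑ {x = y} {x} (λ f → sym (e f))))
    ; natural     = λ g x f → T-ext {0}
        (λ p → ⇒∈rigid β x (g ∘ f) λ d β≡ h →
          subst (_∈ x) (sym (assoc g f h)) (∈rigid⇒ β (Ω[ g ] x) f p d β≡ h))
        (λ p → ⇒∈rigid β (Ω[ g ] x) f λ d β≡ h →
          subst (_∈ x) (assoc g f h) (∈rigid⇒ β x (g ∘ f) p d β≡ h))
    ; preserves-⊤ = λ f → Equivalence.to T-≡ (⇒∈rigid β ⊤ f λ _ _ _ → tt)
    ; idempotent  = λ {a} x f → T-ext {0}
        (λ p → ⇒∈rigid β x f λ d β≡ g →
          -- The closure is tested at `g`, and then once more at the same `d` along `idn`.
          subst (_∈ x) (identityʳ (f ∘ g))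
            (∈rigid⇒ β x (f ∘ g) (∈rigid⇒ β (rigid β a x) f p d β≡ g) d β≡ idn))
        (λ p → ⇒∈rigid β (rigid β a x) f λ d β≡ g → closed (rigid β a x) f g p)
    ; preserves-⊓ = λ x y f → T-ext {0}
        (λ p → Equivalence.from T-∧
          ( ⇒∈rigid β x f (λ d β≡ g → proj₁ (Equivalence.to T-∧ (∈rigid⇒ β (x ⊓ y) f p d β≡ g)))
          , ⇒∈rigid β y f (λ d β≡ g → proj₂ (Equivalence.to T-∧ (∈rigid⇒ β (x ⊓ y) f p d β≡ g)))))
        (λ p → let (q , r) = Equivalence.to T-∧ p in
          ⇒∈rigid β (x ⊓ y) f λ d β≡ g →
            Equivalence.from T-∧ (∈rigid⇒ β x f q d β≡ g , ∈rigid⇒ β y f r d β≡ g))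
    }

  -- Boundaries, and the rigidity of every topology.

  record IsBoundary (∂ : ∀ a → Ω a) : Set where
    field
      size     : Obj → ℕ
      id∉∂     : ∀ {a} → ¬ (idn ∈ ∂ a)
      split    : ∀ {a b} (f : b ⇒ a) → ¬ (f ∈ ∂ a) → ∃[ s ] f ∘ s ≡ idn
      shrink   : ∀ {a b} (f : b ⇒ a) → f ∈ ∂ a →
                 ∃[ c ] size c < size a × Σ[ m ∈ c ⇒ a ] ∃[ e ] f ≡ m ∘ e

    -- A map outside `∂ a` has a section, and composing with it would put the identity into `x`.
    -- Hence `∂ a` is the largest sieve without the identity.
    ⊑∂ : ∀ {a} (x : Ω a) → ¬ (idn ∈ x) → x ⊑ ∂ a
    ⊑∂ {a} x id∉ f f∈ = decidable-stable (T? _) λ f∉ →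
      let (s , eq) = split f f∉ in id∉ (subst (_∈ x) eq (closed x f s f∈))

  module _ {∂ : ∀ a → Ω a} (B : IsBoundary ∂) (j : Operator) (t : IsTopology j) where
    open IsBoundary B
    open IsTopology t

    -- Preservation of meets suffices, as `x ⊑ y` amounts to `x ≈ x ⊓ y`.
    j-mono : ∀ {a} (x y : Ω a) → x ⊑ y → j a x ⊑ j a y
    j-mono {a} x y p f f∈ = proj₂ (Equivalence.to T-∧ (subst T
      (trans (cong-≈ {x = x} {x ⊓ y} (⊑-antisym {x = x} {x ⊓ y}
                (λ g g∈ → Equivalence.from T-∧ (g∈ , p g g∈))
                (λ g g∈ → proj₁ (Equivalence.to T-∧ g∈))) f)
             (preserves-⊓ x y f)) f∈))

    -- The covering sieves of the Grothendieck topology corresponding to `j`.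
    Covers : ∀ {a} → Ω a → Set
    Covers {a} x = idn ∈ j a x

    module _ {a b} (f : b ⇒ a) (x : Ω a) where

      private
        -- Naturality read at the identity; through it `j` is recovered from its covering sieves.
        eq : mem (j b (Ω[ f ] x)) idn ≡ mem (j a x) f
        eq = trans (natural f x idn) (cong (mem (j a x)) (identityʳ f))

      covers⇒∈ : Covers (Ω[ f ] x) → f ∈ j a x
      covers⇒∈ = subst T eq

      ∈⇒covers : f ∈ j a x → Covers (Ω[ f ] x)
      ∈⇒covers = subst T (sym eq)

    id∈⇒covers : ∀ {a} (x : Ω a) → idn ∈ x → Covers x
    id∈⇒covers x id∈ = subst T
      (sym (trans (cong-≈ {x = x} {⊤} (id∈⇒≈⊤ x id∈) idn) (preserves-⊤ idn))) tt

    -- The hypothesis says `r ⊑ j a x`; monotonicity and idempotence do the rest.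
    covers-transitive : ∀ {a} (r x : Ω a) → Covers r →
      (∀ {b} (f : b ⇒ a) → f ∈ r → Covers (Ω[ f ] x)) → Covers x
    covers-transitive {a} r x r-covers p = subst T (idempotent x idn)
      (j-mono r (j a x) (λ f f∈ → covers⇒∈ f x (p f f∈)) idn r-covers)

    covers-pullback : ∀ {a b} (f : b ⇒ a) (x : Ω a) → Covers x → Covers (Ω[ f ] x)
    covers-pullback {a} f x c = ∈⇒covers f x (id∈⇒∈ (j a x) c f)

    filled∂ : Obj → Bool
    filled∂ a = mem (j a (∂ a)) idn

    -- Without the identity, `x` would lie in `∂ a`, and `∂ a` would cover along with it.
    ¬filled∂⇒id∈ : ∀ {a} (x : Ω a) → filled∂ a ≡ false → Covers x → idn ∈ x
    ¬filled∂⇒id∈ {a} x β≡ c = decidable-stable (T? _) λ id∉ →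
      subst T β≡ (j-mono x (∂ a) (⊑∂ x id∉) idn c)

    -- If `∂ c` covered, so would its pullback along `r`. That pullback then contains the identity
    -- of `a`, so `r` and with it `r ∘ s` lie in `∂ c`, which excludes the identity.
    filled∂-retract : ∀ {a c} (s : c ⇒ a) (r : a ⇒ c) → r ∘ s ≡ idn →
                      filled∂ a ≡ false → filled∂ c ≡ false
    filled∂-retract {a} {c} s r rs a≡ with filled∂ c in c≡
    ... | false = refl
    ... | true  = contradiction
      (subst (_∈ ∂ c) rs (closed (∂ c) r s (subst (_∈ ∂ c) (identityʳ r)
        (¬filled∂⇒id∈ (Ω[ r ] (∂ c)) a≡
          (covers-pullback r (∂ c) (Equivalence.from T-≡ c≡))))))
      id∉∂

    -- Induction on size. If the boundary does not cover, `a` is in D and the identity itself is in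
    -- `x`. Otherwise it is enough to cover after pulling back along the boundary, whose maps factor
    -- through smaller objects.
    detected⇒covers : ∀ {a} → Acc _<_ (size a) → (x : Ω a) →
                      (∀ d → filled∂ d ≡ false → (g : d ⇒ a) → g ∈ x) → Covers x
    detected⇒covers {a} (acc rec) x p with filled∂ a in a≡
    ... | false = id∈⇒covers x (p a a≡ idn)
    ... | true  = covers-transitive (∂ a) x (Equivalence.from T-≡ a≡) λ f f∈ →
      let (c , c< , m , e , eq) = shrink f f∈ in
      ∈⇒covers f x (subst (_∈ j a x) (sym eq) (closed (j a x) m e
        (covers⇒∈ m x (detected⇒covers (rec c<) (Ω[ m ] x) λ d β≡ g → p d β≡ (m ∘ g)))))

    -- An object of D is covered only by sieves containing its identity, which gives one inclusion;
    -- `detected⇒covers` gives the other.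
    ≋rigid : j ≋ᵒ rigid filled∂
    ≋rigid a x f = T-ext {0}
      (λ f∈ → ⇒∈rigid filled∂ x f λ d β≡ g → subst (_∈ x) (identityʳ (f ∘ g))
        (¬filled∂⇒id∈ (Ω[ f ∘ g ] x) β≡ (∈⇒covers (f ∘ g) x (closed (j a x) f g f∈))))
      (λ f∈ → covers⇒∈ f x (detected⇒covers (<-wellFounded _) (Ω[ f ] x) (∈rigid⇒ filled∂ x f f∈)))

    -- This is the common form of the two clauses of `level` that return `filled`.
    fill : ∀ {a} (x : Ω a) → ¬ (idn ∈ x) → ∂ a ⊑ j a x →
           j a x ≈ (if filled∂ a then ⊤ else ∂ a)
    fill {a} x id∉ p with filled∂ a in a≡
    ... | true  = id∈⇒≈⊤ (j a x) (covers-transitive (∂ a) x (Equivalence.from T-≡ a≡)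
                    (λ f f∈ → ∈⇒covers f x (p f f∈)))
    ... | false = ⊑-antisym {x = j a x} {∂ a}
                    (⊑∂ (j a x) (λ c → id∉ (¬filled∂⇒id∈ x a≡ c))) p

  module _ {∂ : ∀ a → Ω a} (B : IsBoundary ∂) (β : Obj → Bool) where
    open IsBoundary B

    -- Recovers `β` from its topology. If `β a` is `true`, maps from D into `a` must lie in `∂ a`,
    -- so `∂ a` covers; if it is `false`, testing at `a` itself would put the identity into `∂ a`.
    filled∂-rigid : ∀ a → (∀ c (f : c ⇒ a) → ¬ (f ∈ ∂ a) → β c ≡ β a) →
                    filled∂ B (rigid β) (rigid-isTopology β) a ≡ β a
    filled∂-rigid a β-const with β a in a≡
    ... | true  = Equivalence.to T-≡ (⇒∈rigid β (∂ a) idn λ d d≡ g → decidable-stable (T? _) λ g∉ →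
      contradiction (trans (sym (β-const d (idn ∘ g) g∉)) d≡) λ ())
    ... | false = T-ext {0} {q = false}
      (λ id∈ → id∉∂ (subst (_∈ ∂ a) (identityˡ idn) (∈rigid⇒ β (∂ a) idn id∈ a a≡ idn))) (λ ())

    rigid-fill : ∀ {a} → (∀ c (f : c ⇒ a) → ¬ (f ∈ ∂ a) → β c ≡ β a) →
                 (x : Ω a) → ¬ (idn ∈ x) → ∂ a ⊑ rigid β a x →
                 rigid β a x ≈ (if β a then ⊤ else ∂ a)
    rigid-fill {a} β-const x id∉ ∂⊑ f = trans
      (fill B (rigid β) (rigid-isTopology β) x id∉ ∂⊑ f)
      (cong (λ t → mem (if t then ⊤ else ∂ a) f) (filled∂-rigid a β-const))

  rigid-injective : ∀ {∂ : ∀ a → Ω a} → IsBoundary ∂ → ∀ {β β′} a →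
    (∀ c (f : c ⇒ a) → ¬ (f ∈ ∂ a) → β c ≡ β a) →
    (∀ c (f : c ⇒ a) → ¬ (f ∈ ∂ a) → β′ c ≡ β′ a) →
    rigid β ≋ᵒ rigid β′ → β a ≡ β′ a
  rigid-injective {∂} B {β} {β′} a β-const β′-const e = trans
    (sym (filled∂-rigid B β a β-const)) (trans (e a (∂ a) idn) (filled∂-rigid B β′ a β′-const))

-- The decisions are split into a Boolean and its Reflects proof so that the
-- propositions and proofs can be found by unification, given only the shape of
-- the Booleans.
if-elim₃ : ∀ {A : Set} (Q : A → Set) {L u v y : A} {P P′ P″ : Set} (t t′ t″ : Bool)
           {p : Reflects P t} {p′ : Reflects P′ t′} {p″ : Reflects P″ t″} →
           L ≡ (if ⌊ t because p ⌋ then u else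
                if ⌊ t′ because p′ ⌋ then v else
                if ⌊ t″ because p″ ⌋ then v else y) →
           (P → Q u) → (¬ P → P′ → Q v) → (¬ P → P″ → Q v) → (¬ P″ → Q y) → Q L
if-elim₃ Q true  _     _     {ofʸ p}  {_}       {_}        refl f g h i = f p
if-elim₃ Q false true  _     {ofⁿ ¬p} {ofʸ p′}  {_}        refl f g h i = g ¬p p′
if-elim₃ Q false false true  {ofⁿ ¬p} {ofⁿ _}   {ofʸ p″}   refl f g h i = h ¬p p″
if-elim₃ Q false false false {ofⁿ ¬p} {ofⁿ _}   {ofⁿ ¬p″}  refl f g h i = i ¬p″

-- Sorted words.

Sorted : ∀ {m} → Vec Bool m → Set
Sorted w = ∀ i j → i Fin.≤ j → lookup w j ≡ false → lookup w i ≡ false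

sorted⇒zerosThenOnes : ∀ {m} (w : Vec Bool m) → Sorted w →
  ∃[ l ] l ≤ m × toList w ≡ replicate l false ++ replicate (m ∸ l) true
sorted⇒zerosThenOnes []          s = 0 , z≤n , refl
sorted⇒zerosThenOnes (false ∷ w) s =
  let (l , l≤ , eq) = sorted⇒zerosThenOnes w (λ i j i≤j → s (suc i) (suc j) (s≤s i≤j)) in
  suc l , s≤s l≤ , cong (false ∷ˡ_) eq
sorted⇒zerosThenOnes (true ∷ w)  s =
  -- A later `false` would force the leading bit to be `false` as well.
  0 , z≤n , cong (true ∷ˡ_) (ones w λ i eq → case s zero (suc i) z≤n eq of λ ())
  where
  ones : ∀ {m} (w : Vec Bool m) → (∀ i → lookup w i ≢ false) → toList w ≡ replicate m true
  ones []          _ = refl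
  ones (true ∷ w)  p = cong (true ∷ˡ_) (ones w λ i → p (suc i))
  ones (false ∷ w) p = contradiction refl (p zero)

zerosThenOnes⇒sorted : ∀ {m} (w : Vec Bool m) l →
  toList w ≡ replicate l false ++ replicate (m ∸ l) true → Sorted w
zerosThenOnes⇒sorted (x ∷ w) zero    eq i       j       _         wj =
  contradiction (trans (sym (ones (x ∷ w) eq j)) wj) λ ()
  where
  ones : ∀ {m} (w : Vec Bool m) → toList w ≡ replicate m true → ∀ j → lookup w j ≡ true
  ones (_ ∷ _) eq zero    = proj₁ (∷-injective eq)
  ones (_ ∷ w) eq (suc j) = ones w (proj₂ (∷-injective eq)) j
zerosThenOnes⇒sorted (x ∷ w) (suc l) eq zero    j       _         _  = proj₁ (∷-injective eq)
zerosThenOnes⇒sorted (x ∷ w) (suc l) eq (suc i) (suc j) (s≤s i≤j) wj =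
  zerosThenOnes⇒sorted w l (proj₂ (∷-injective eq)) i j i≤j wj

-- Sections, images and retractions of monotone maps.

module _ {l k : ℕ} where

  Omits : l ⟶ k → Fin (suc k) → Set
  Omits f i = ∀ j → i ≢ f at j

  omits? : (f : l ⟶ k) → Dec (∃ (Omits f))
  omits? f = any? λ i → all? λ j → ¬? (i ≟ᶠ f at j)

  ¬omits⇒surjective : (f : l ⟶ k) → ¬ ∃ (Omits f) → ∀ i → ∃[ j ] i ≡ f at j
  ¬omits⇒surjective f ¬o i =
    decidable-stable (any? λ j → i ≟ᶠ f at j) (λ ¬j → ¬o (i , λ j eq → ¬j (j , eq)))

  monotone-section : (f : l ⟶ k) → (∀ i → ∃[ j ] i ≡ f at j) →
                     Σ[ s ∈ k ⟶ l ] f ⊙ s ≡ id⟶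
  monotone-section f surj = s , ⟶-ext λ i →
      trans (⊙-at f s i) (trans (cong (f at_) (fromFun-at inv inv-mono i))
        (trans (sym (proj₂ (surj i))) (sym (id-at i))))
    where
    inv : Fin (suc k) → Fin (suc l)
    inv i = proj₁ (surj i)
    inv-mono : ∀ i j → i Fin.≤ j → inv i Fin.≤ inv j
    inv-mono i j i≤j with ≤ᶠ-total (inv i) (inv j)
    ... | inj₁ le = le
    -- If the chosen preimages come in reverse order, monotonicity of `f` forces `i ≡ j`.
    ... | inj₂ ge = subst (λ z → inv i Fin.≤ inv z)
      (≤ᶠ-antisym i≤j (subst₂ Fin._≤_ (sym (proj₂ (surj j))) (sym (proj₂ (surj i))) (at-mono f ge)))
      ≤ᶠ-refl
    s : k ⟶ l
    s = fromFun inv inv-mono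

section⇒≤ : ∀ {k l} (r : l ⟶ k) (s : k ⟶ l) → r ⊙ s ≡ id⟶ → k ≤ l
section⇒≤ r s rs = ≤-pred (injective⇒≤ {f = s at_} λ {i} {j} eq →
  trans (sym (id-at i)) (trans (sym (cong (_at i) rs)) (trans (⊙-at r s i)
    (trans (cong (r at_) eq) (trans (sym (⊙-at r s j)) (trans (cong (_at j) rs) (id-at j)))))))

factor-δ⟶ : ∀ {l k} (f : l ⟶ suc k) i → Omits f i → ∃[ g ] f ≡ incl (δ i) ⊙ g
factor-δ⟶ {l} {k} f i i∉ = g , ⟶-ext λ j → sym
    (trans (⊙-at (incl (δ i)) g j)
      (trans (cong (incl (δ i) at_) (fromFun-at (λ j → punchOut (i∉ j)) g-mono j))
        (trans (fromFun-at (punchIn i) (punchIn-mono-≤ i) _) (punchIn-punchOut (i∉ j)))))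
  where
  g-mono : ∀ j j′ → j Fin.≤ j′ → punchOut (i∉ j) Fin.≤ punchOut (i∉ j′)
  g-mono j j′ j≤j′ = punchOut-mono-≤ (i∉ j) (i∉ j′) (at-mono f j≤j′)
  g : l ⟶ k
  g = fromFun (λ j → punchOut (i∉ j)) g-mono

δ-omits : ∀ {k} (i : Fin (suc (suc k))) → Omits (incl (δ i)) i
δ-omits i j eq = punchInᵢ≢i i j (trans (sym (fromFun-at (punchIn i) (punchIn-mono-≤ i) j)) (sym eq))

-- Collapsing repeated values one at a time ends at an injection. The bound `p ≤ l` keeps the new
-- source inside a downward closed D.
image : ∀ {l k} (f : l ⟶ k) →
        ∃[ p ] p ≤ l × Σ[ m ∈ p ↪ k ] Σ[ e ∈ l ⟶ p ] f ≡ incl m ⊙ e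
image {zero} f = zero , ≤-refl , mk f (λ { zero zero _ → refl }) , id⟶ , sym (⊙-identityʳ f)
image {suc l} f with injective⊎repeat f
... | inj₁ inj = suc l , ≤-refl , mk f inj , id⟶ , sym (⊙-identityʳ f)
... | inj₂ (i , r) with image (f ⊙ incl (δ (inject₁ i)))
...   | p , p≤ , m , e , eq = p , ≤-trans p≤ (n≤1+n l) , m , e ⊙ σ i ,
  trans (factor-σ f i r) (trans (cong (_⊙ σ i) eq) (⊙-assoc (incl m) e (σ i)))

-- Composes the retractions `σ zero` of `δ zero` along the chain from `k` to `l`.
retraction : ∀ {k l} → k ≤′ l → Σ[ s ∈ k ⟶ l ] Σ[ r ∈ l ⟶ k ] r ⊙ s ≡ id⟶
retraction ≤′-refl = id⟶ , id⟶ , ⊙-identityˡ id⟶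
retraction (≤′-step {l} k≤l) with retraction k≤l
... | s , r , rs = incl (δ zero) ⊙ s , r ⊙ σ zero , trans (⊙-assoc r (σ zero) (incl (δ zero) ⊙ s))
    (trans (cong (r ⊙_) (trans (sym (⊙-assoc (σ zero) (incl (δ zero)) s))
      (trans (cong (_⊙ s) σδ≡id) (⊙-identityˡ s)))) rs)
  where
  σδ≡id : σ {l} zero ⊙ incl (δ zero) ≡ id⟶
  σδ≡id = ⟶-ext λ i → trans (⊙-at (σ zero) (incl (δ zero)) i)
    (trans (cong (σ zero at_) (fromFun-at (punchIn zero) (punchIn-mono-≤ zero) i))
      (trans (fromFun-at (pinch zero) (λ _ _ → pinch-mono-≤ zero) (suc i)) (sym (id-at i))))

-- The simplicial boundary, and rigid topologies under `F`.

module _ {n : ℕ} where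

  private
    module C  = Classifier (Δ≤ n)
    module C₊ = Classifier (Δ₊≤ n)
    module R  = Sieves (Δ≤ n)
    module R₊ = Sieves (Δ₊≤ n)

  -- The non-surjective maps: the usual boundary of a simplex, degenerate simplices included.
  simplicialBoundary : ∀ a → C.Ω a
  simplicialBoundary a = C.comprehension {P = λ f → ∃ (Omits f)} omits?
    (λ f g (i , i∉) → i , λ j eq → i∉ (g at j) (trans eq (⊙-at f g j)))

  simplicialBoundary-isBoundary : R.IsBoundary simplicialBoundary
  simplicialBoundary-isBoundary = record
    { size   = dim
    ; id∉∂   = λ {a} id∈ →
        let (i , i∉) = toWitness {a? = omits? (id⟶ {dim a})} id∈ in i∉ i (sym (id-at i))
    ; split  = λ f f∉ →
        monotone-section f (¬omits⇒surjective f λ o → f∉ (fromWitness {a? = omits? f} o))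
    ; shrink = λ {a} {b} f f∈ → shrink a (dim b) f (toWitness {a? = omits? f} f∈)
    }
    where
    shrink : ∀ a l (f : l ⟶ dim a) → ∃ (Omits f) →
             ∃[ c ] dim c < dim a × Σ[ m ∈ dim {n} c ⟶ dim a ] ∃[ e ] f ≡ m ⊙ e
    -- A map to the one-point ordinal omits nothing, so this case is void.
    shrink (ob zero b) l f (zero , i∉) with f at zero in eq
    ... | zero = contradiction (sym eq) (i∉ zero)
    shrink (ob (suc k) b) l f (i , i∉) =
      below b , ≤-refl , incl (δ i) , factor-δ⟶ f i i∉

  DownClosed : (Ob n → Bool) → Set
  DownClosed β = ∀ a c → dim c ≤ dim a → β a ≡ false → β c ≡ false

  ∈F⁻¹⇒ : ∀ {k} (y : C.Ω k) (a : Ob n) (f : dim a ↪ dim k) →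
          C₊._∈_ {b = a} f (F⁻¹ k y) → C._∈_ {b = a} (incl f) y
  ∈F⁻¹⇒ y (ob l b) f f∈ = proj₁ (toWitness
    {a? = simplices? y l b (incl f) ×-dec ¬? (degen? (simplices? y) l b (incl f))} f∈)

  ⇒∈F⁻¹ : ∀ {k} (y : C.Ω k) (a : Ob n) (f : dim a ↪ dim k) →
          C._∈_ {b = a} (incl f) y → C₊._∈_ {b = a} f (F⁻¹ k y)
  ⇒∈F⁻¹ y (ob l b) f f∈ = fromWitness
    {a? = simplices? y l b (incl f) ×-dec ¬? (degen? (simplices? y) l b (incl f))}
    (f∈ , degen-not-injective l b f)

  shrinkTo : ∀ (d : Ob n) {p} → p ≤ dim d → Ob n
  shrinkTo (ob l b) {p} p≤ = ob p (≤-trans p≤ b)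

  FactoredThrough : ∀ {k} → C₊.Ω k → (a : Ob n) → dim a ⟶ dim k → Set
  FactoredThrough x (ob l b) f = Factored x l b f

  ∈F⇒ : ∀ {k} (x : C₊.Ω k) (a : Ob n) (f : dim a ⟶ dim k) →
        C._∈_ {b = a} f (F k x) → FactoredThrough x a f
  ∈F⇒ x (ob l b) f f∈ = toFactored x l b f (toWitness
    {a? = simplices₊? x l b f ⊎-dec degen? (simplices₊? x) l b f} f∈)

  ⇒∈F : ∀ {k} (x : C₊.Ω k) (a : Ob n) (f : dim a ⟶ dim k) →
        FactoredThrough x a f → C._∈_ {b = a} f (F k x)
  ⇒∈F x (ob l b) _ (p , u , e , u∈ , refl) = fromWitness
    {a? = simplices₊? x l b (incl u ⊙ e) ⊎-dec degen? (simplices₊? x) l b (incl u ⊙ e)}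
    (fromFactored x p l b u e u∈)

  -- If `incl u ⊙ e` is injective, so is `e`, and closedness of `x` applies: `F` adds no injective
  -- maps.
  ∈F-incl⇒ : ∀ {k} (x : C₊.Ω k) (a : Ob n) (f : dim a ↪ dim k) →
             C._∈_ {b = a} (incl f) (F k x) → C₊._∈_ {b = a} f x
  ∈F-incl⇒ x a f f∈ with ∈F⇒ x a (incl f) f∈
  ... | p , u , e , u∈ , eq = subst (λ h → C₊._∈_ {b = a} h x) {x = u ⊙₊ e₊} (↪-incl (sym eq))
      (C₊.closed x {b = p} {c = a} u e₊ u∈)
    where
    e₊ : dim a ↪ dim p
    e₊ = mk e λ i j eq′ → at-inj f (trans (cong (_at i) eq) (trans (⊙-at (incl u) e i)
      (trans (cong (incl u at_) eq′) (trans (sym (⊙-at (incl u) e j)) (sym (cong (_at j) eq))))))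

  -- One inclusion tests injective maps only. Conversely a monotone `g` out of D factors through its
  -- image, whose injective part starts in D by downward closure.
  F⁻¹-rigid-F : ∀ β → DownClosed β → C₊._≋_ (F⁻¹∘ R.rigid β ∘F) (R₊.rigid β)
  F⁻¹-rigid-F β down k x {a} f = T-ext {n}
    (λ f∈ → R₊.⇒∈rigid β {a = k} {a} x f λ d β≡ g → ∈F-incl⇒ x d (f ⊙₊ g)
      (R.∈rigid⇒ β {a = k} {a} (F k x) (incl f) (∈F⁻¹⇒ (R.rigid β k (F k x)) a f f∈) d β≡ (incl g)))
    (λ f∈ → ⇒∈F⁻¹ (R.rigid β k (F k x)) a f (R.⇒∈rigid β {a = k} {a} (F k x) (incl f) λ d β≡ g →
      let (p , p≤ , m , e , eq) = image g
          p′ = shrinkTo d p≤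
      in ⇒∈F x d (incl f ⊙ g) (p′ , f ⊙₊ m , e ,
           R₊.∈rigid⇒ β {a = k} {a} x f f∈ p′ (down d p′ p≤ β≡) m ,
           trans (cong (incl f ⊙_) eq) (sym (⊙-assoc (incl f) (incl m) e)))))

  F⁻¹-F-cong : ∀ {j j′ : C.Operator} → C._≋_ j j′ → C₊._≋_ (F⁻¹∘ j ∘F) (F⁻¹∘ j′ ∘F)
  F⁻¹-F-cong {j} {j′} e k x {a} f = T-ext {n}
    (λ f∈ → ⇒∈F⁻¹ (j′ k (F k x)) a f (subst T (e k (F k x) {a} (incl f)) (∈F⁻¹⇒ (j k (F k x)) a f f∈)))
    (λ f∈ → ⇒∈F⁻¹ (j k (F k x)) a f (subst T (sym (e k (F k x) {a} (incl f))) (∈F⁻¹⇒ (j′ k (F k x)) a f f∈)))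

  filled∂-downClosed : (j : S.Topology n) →
    DownClosed (R.filled∂ simplicialBoundary-isBoundary (S.op j) (S.isTopology j))
  filled∂-downClosed j a c c≤a =
    let (s , r , rs) = retraction (≤⇒≤′ c≤a) in
    R.filled∂-retract simplicialBoundary-isBoundary (S.op j) (S.isTopology j) {a} {c} s r rs

  -- The semisimplicial boundary, and rigidity of `j^ w`.

  ∈∂⇒ : ∀ {k} .(b : suc k ≤ n) c (f : dim c ↪ suc k) →
        C₊._∈_ {b = c} f (boundary (ob (suc k) b)) → InBoundary {n} f
  ∈∂⇒ b c f = toWitness {a? = inBoundary? {n} f}

  ⇒∈∂ : ∀ {k} .(b : suc k ≤ n) c (f : dim c ↪ suc k) →
        InBoundary {n} f → C₊._∈_ {b = c} f (boundary (ob (suc k) b))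
  ⇒∈∂ b c f = fromWitness {a? = inBoundary? {n} f}

  inBoundary⊎section : ∀ {k l} (f : l ↪ suc k) → InBoundary {n} f ⊎ ∃[ s ] f ⊙₊ s ≡ id↪
  inBoundary⊎section f with omits? (incl f)
  ... | yes (i , i∉) = inj₁ (i , factor-δ {n} f i i∉)
  ... | no ¬o        = inj₂ (section {n} f (¬omits⇒surjective (incl f) ¬o))

  section₀ : ∀ {l} (f : l ↪ 0) → ∃[ s ] f ⊙₊ s ≡ id↪
  section₀ f = section {n} f λ { zero → zero , lemma (incl f at zero) }
    where
    lemma : (i : Fin 1) → zero ≡ i
    lemma zero = refl

  boundary-isBoundary : R₊.IsBoundary boundary
  boundary-isBoundary = record
    { size   = dim
    ; id∉∂   = λ {a} → id∉∂ a
    ; split  = λ {a} {c} → split a c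
    ; shrink = λ {a} {c} → shrink a c
    }
    where
    id∉∂ : ∀ a → ¬ C₊._∈_ {b = a} id↪ (boundary a)
    id∉∂ (ob (suc k) b) id∈ =
      let (i , g , eq) = ∈∂⇒ b (ob (suc k) b) id↪ id∈ in δ-omits i (incl g at i)
        (trans (sym (id-at i)) (trans (cong (λ h → incl h at i) eq) (⊙-at (incl (δ i)) (incl g) i)))
    split : ∀ a c (f : dim c ↪ dim a) → ¬ C₊._∈_ {b = c} f (boundary a) → ∃[ s ] f ⊙₊ s ≡ id↪
    split (ob zero b)    c f f∉ = section₀ f
    split (ob (suc k) b) c f f∉ =
      fromInj₂ (λ f∈ → contradiction (⇒∈∂ b c f f∈) f∉) (inBoundary⊎section f)
    shrink : ∀ a c (f : dim c ↪ dim a) → C₊._∈_ {b = c} f (boundary a) →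
             ∃[ p ] dim p < dim a × Σ[ m ∈ dim {n} p ↪ dim a ] ∃[ e ] f ≡ m ⊙₊ e
    shrink (ob (suc k) b) c f f∈ =
      let (i , g , eq) = ∈∂⇒ b c f f∈ in below b , ≤-refl , δ i , g , eq

  same-dim : (β : Ob n → Bool) → ∀ a c → dim c ≡ dim a → β c ≡ β a
  same-dim β (ob k b) (ob .k b′) refl = refl

  -- Injectivity bounds one dimension and the section the other. Thus any `β` is constant along maps
  -- outside the boundary.
  ∉∂⇒dim≡ : ∀ a c (f : dim c ↪ dim a) →
            ¬ C₊._∈_ {b = c} f (boundary a) → dim c ≡ dim a
  ∉∂⇒dim≡ a c f f∉ = let (s , eq) = R₊.IsBoundary.split boundary-isBoundary {a} {c} f f∉ in
    ≤-antisym (≤-pred (injective⇒≤ {f = incl f at_} (at-inj f)))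
      (section⇒≤ (incl f) (incl s) (cong incl eq))

  bits : Vec Bool (suc n) → Ob n → Bool
  bits w (ob k b) = bit w k b

  -- Induction on dimension: naturality along `δ i` gives the closure of `x` the incidence tuple
  -- used by `level`, and `rigid-fill` settles the cases where the closure contains the boundary.
  rigid₊≈level : ∀ w k .(b : k ≤ n) (x : C₊.Ω (ob k b)) →
                 C₊._≈_ (R₊.rigid (bits w) (ob k b) x) (level w k b x)
  rigid₊≈level w zero b x = by-cases (T? (C₊.mem x {a} id↪))
    where
    a = ob zero b
    J = R₊.rigid (bits w)
    ⊤≈if : ∀ t → C₊._≈_ x C₊.⊤ → C₊._≈_ C₊.⊤ (if t then C₊.⊤ else x)
    ⊤≈if false x≈⊤ {c} f = sym (x≈⊤ {c} f)
    ⊤≈if true  x≈⊤ f = refl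
    -- In dimension 0 the boundary is empty, and so is any `x` without the identity.
    ∂≈x : ∀ t → ¬ C₊._∈_ {b = a} id↪ x →
          C₊._≈_ (if t then C₊.⊤ else boundary a) (if t then C₊.⊤ else x)
    ∂≈x true  id∉ f = refl
    ∂≈x false id∉ {c} f = T-ext {n} {p = false} (λ ())
      (R₊.IsBoundary.⊑∂ boundary-isBoundary {a} x id∉ {c} f)
    by-cases : Dec (C₊._∈_ {b = a} id↪ x) → C₊._≈_ (J a x) (if bits w a then C₊.⊤ else x)
    by-cases (yes id∈) {c} f = trans
      (R₊.id∈⇒≈⊤ {a} (J a x) (R₊.⊑rigid (bits w) {a} x {a} id↪ id∈) {c} f)
      (⊤≈if (bits w a) (R₊.id∈⇒≈⊤ {a} x id∈) {c} f)
    by-cases (no id∉) {c} f = trans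
      (R₊.rigid-fill boundary-isBoundary (bits w) {a}
        (λ c f f∉ → same-dim (bits w) a c (∉∂⇒dim≡ a c f f∉)) x id∉ (λ _ ()) {c} f)
      (∂≈x (bits w a) id∉ {c} f)
  rigid₊≈level w (suc k) b x =
    -- The three Booleans spell out how the searches in level unfold up to the
    -- first membership test, whose neutrality lets unification solve the rest.
    -- Writing the decisions in full is not feasible: they differ syntactically
    -- from those in level, so conversion checking would unfold the searches.
    if-elim₃ Goal {L = level w (suc k) b x}
      (not ((not (does (C₊.mem x {ob 0 z≤n} _ ≟ᵇ _)) ∨ _) ∨ _))
      (not ((not (does (C₊.mem x {ob 0 z≤n} _ ≟ᵇ _)) ∨ _) ∨ _))
      (not ((not (does (C₊.mem (z zero) {ob 0 z≤n} _ ≟ᵇ _)) ∨ _) ∨ _) ∧ _)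
      refl
      whenTop
      (λ x≉⊤ x≈∂ → filled x≉⊤ (∂⊑x x≈∂))
      (λ x≉⊤ z≈⊤ → filled x≉⊤ (∂⊑ z≈⊤))
      (withIncidence-unique b z (J a x) y~z)
    where
    a = ob (suc k) b
    β = bits w
    J = R₊.rigid β
    Goal : C₊.Ω a → Set
    Goal y = C₊._≈_ (J a x) y
    z : Tuple b
    z i = level w k (<⇒≤ b) (incidence b x i)
    y~z : ∀ i → C₊._≈_ (incidence b (J a x) i) (z i)
    y~z i {c} f = trans
      (sym (C₊.IsTopology.natural (R₊.rigid-isTopology β) {below b} {a} (δ i) x {c} f))
      (rigid₊≈level w k (<⇒≤ b) (incidence b x i) {c} f)
    ∂⊑J = R₊._⊑_ {a} (boundary a) (J a x)
    whenTop : C₊._≈_ x C₊.⊤ → Goal C₊.⊤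
    whenTop x≈⊤ = R₊.id∈⇒≈⊤ {a} (J a x)
      (R₊.⊑rigid β {a} x {a} id↪ (Equivalence.from T-≡ (x≈⊤ {a} id↪)))
    filled : ¬ C₊._≈_ x C₊.⊤ → ∂⊑J → Goal (if bit w (suc k) b then C₊.⊤ else boundary a)
    filled x≉⊤ = R₊.rigid-fill boundary-isBoundary β {a}
      (λ c f f∉ → same-dim β a c (∉∂⇒dim≡ a c f f∉)) x (λ id∈ → x≉⊤ (R₊.id∈⇒≈⊤ {a} x id∈))
    ∂⊑x : C₊._≈_ x (boundary a) → ∂⊑J
    ∂⊑x x≈∂ {c} f f∈ = R₊.⊑rigid β {a} x {c} f (subst T (sym (x≈∂ {c} f)) f∈)
    ∂⊑ : (∀ i → C₊._≈_ (z i) C₊.⊤) → ∂⊑J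
    ∂⊑ z≈⊤ {c} f f∈ =
      let (i , g , eq) = ∈∂⇒ b c f f∈ in
      subst (λ h → C₊._∈_ {b = c} h (J a x)) (sym eq)
        (Equivalence.from T-≡ (trans (y~z i {c} g) (z≈⊤ i {c} g)))

  rigid₊≋j^ : ∀ w → C₊._≋_ (R₊.rigid (bits w)) (j^ w)
  rigid₊≋j^ w (ob k b) x {a} f = rigid₊≈level w k b x {a} f

  -- Words as sets of dimensions.

  dimension : Fin (suc n) → Ob n
  dimension i = ob (toℕ i) (≤-pred (toℕ<n i))

  word : (Ob n → Bool) → Vec Bool (suc n)
  word β = tabulate λ i → β (dimension i)

  bits-word : ∀ β a → bits (word β) a ≡ β a
  bits-word β (ob k b) = trans (lookup∘tabulate (λ i → β (dimension i)) (fromℕ< (s≤s b)))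
    (same-dim β (ob k b) (dimension (fromℕ< (s≤s b))) (toℕ-fromℕ< (s≤s b)))

  bits-lookup : ∀ w i → bits w (dimension i) ≡ lookup w i
  bits-lookup w i = cong (lookup w) (fromℕ<-toℕ i (toℕ<n i))

  downClosed⇒zerosThenOnes : ∀ w → DownClosed (bits w) → ZerosThenOnes w
  downClosed⇒zerosThenOnes w down = sorted⇒zerosThenOnes w λ i j i≤j wj →
    trans (sym (bits-lookup w i)) (down (dimension j) (dimension i) i≤j (trans (bits-lookup w j) wj))

  zerosThenOnes⇒downClosed : ∀ w → ZerosThenOnes w → DownClosed (bits w)
  zerosThenOnes⇒downClosed w (l , _ , eq) (ob k b) (ob k′ b′) k′≤k =
    zerosThenOnes⇒sorted w l eq (fromℕ< (s≤s b′)) (fromℕ< (s≤s b))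
      (subst₂ _≤_ (sym (toℕ-fromℕ< (s≤s b′))) (sym (toℕ-fromℕ< (s≤s b))) k′≤k)

  -- Whether the boundary is filled in a given dimension reads off the bit, so `j^ w` determines
  -- `w`.
  bits-injective : ∀ w w′ → C₊._≋_ (j^ w) (j^ w′) → ∀ a → bits w a ≡ bits w′ a
  bits-injective w w′ e a = R₊.rigid-injective boundary-isBoundary {bits w} {bits w′} a
    (bits-const w) (bits-const w′)
    (R₊.≋-trans {J} {j^ w} {J′} (rigid₊≋j^ w)
      (R₊.≋-trans {j^ w} {j^ w′} {J′} e (R₊.≋-sym {J′} {j^ w′} (rigid₊≋j^ w′))))
    where
    J  = R₊.rigid (bits w)
    J′ = R₊.rigid (bits w′)
    bits-const : ∀ w c (f : dim c ↪ dim a) → ¬ C₊._∈_ {b = c} f (boundary a) →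
                 bits w c ≡ bits w a
    bits-const w c f f∉ = same-dim (bits w) a c (∉∂⇒dim≡ a c f f∉)

  rigidTopology : (Ob n → Bool) → S.Topology n
  rigidTopology β = record { op = R.rigid β ; isTopology = R.rigid-isTopology β }

  -- The word of a simplicial topology, and the bijection.

  module _ (j : S.Topology n) where

    private
      β : Ob n → Bool
      β = R.filled∂ simplicialBoundary-isBoundary (S.op j) (S.isTopology j)

    topologyWord : Vec Bool (suc n)
    topologyWord = word β

    topology≋rigid : C._≋_ (S.op j) (R.rigid (bits topologyWord))
    topology≋rigid = R.≋-trans {S.op j} {R.rigid β} {R.rigid (bits topologyWord)}
      (R.≋rigid simplicialBoundary-isBoundary (S.op j) (S.isTopology j))
      (R.rigid-cong {β} {bits topologyWord} (λ a → sym (bits-word β a)))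

    topologyWord-zerosThenOnes : ZerosThenOnes topologyWord
    topologyWord-zerosThenOnes = downClosed⇒zerosThenOnes topologyWord λ a c c≤a a≡ →
      trans (bits-word β c) (filled∂-downClosed j a c c≤a (trans (sym (bits-word β a)) a≡))

  F⁻¹-rigid-F≋j^ : ∀ w → ZerosThenOnes w → (F⁻¹∘ R.rigid (bits w) ∘F) ≋₊ (j^ w)
  F⁻¹-rigid-F≋j^ w zo = R₊.≋-trans {F⁻¹∘ R.rigid (bits w) ∘F} {R₊.rigid (bits w)} {j^ w}
    (F⁻¹-rigid-F (bits w) (zerosThenOnes⇒downClosed w zo)) (rigid₊≋j^ w)

  F⁻¹-topology-F≋j^ : (j : S.Topology n) → (F⁻¹∘ S.op j ∘F) ≋₊ (j^ topologyWord j)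
  F⁻¹-topology-F≋j^ j = R₊.≋-trans
    {F⁻¹∘ S.op j ∘F} {F⁻¹∘ R.rigid (bits (topologyWord j)) ∘F} {j^ topologyWord j}
    (F⁻¹-F-cong {S.op j} {R.rigid (bits (topologyWord j))} (topology≋rigid j))
    (F⁻¹-rigid-F≋j^ (topologyWord j) (topologyWord-zerosThenOnes j))

  j^-isTopology : ∀ w → S₊.IsTopology n (j^ w)
  j^-isTopology w = R₊.transport-isTopology {R₊.rigid (bits w)} {j^ w}
    (rigid₊≋j^ w) (R₊.rigid-isTopology (bits w))

  -- Transported from `j^ w`, itself a topology because it agrees with a rigid one.
  F⁻¹-F-isTopology : (j : S.Topology n) → S₊.IsTopology n (F⁻¹∘ S.op j ∘F)
  F⁻¹-F-isTopology j = R₊.transport-isTopology {j^ topologyWord j} {F⁻¹∘ S.op j ∘F}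
    (R₊.≋-sym {F⁻¹∘ S.op j ∘F} {j^ topologyWord j} (F⁻¹-topology-F≋j^ j))
    (j^-isTopology (topologyWord j))

  -- Each topology is rigid for its word, and equal images force equal words.
  F⁻¹-F-injective : (j j′ : S.Topology n) → (F⁻¹∘ S.op j ∘F) ≋₊ (F⁻¹∘ S.op j′ ∘F) → j ≋ j′
  F⁻¹-F-injective j j′ e =
    R.≋-trans {S.op j} {R.rigid (bits w)} {S.op j′} (topology≋rigid j)
      (R.≋-trans {R.rigid (bits w)} {R.rigid (bits w′)} {S.op j′}
        (R.rigid-cong (bits-injective w w′ j^w≋j^w′))
        (R.≋-sym {S.op j′} {R.rigid (bits w′)} (topology≋rigid j′)))
    where
    w  = topologyWord j
    w′ = topologyWord j′
    j^w≋j^w′ : (j^ w) ≋₊ (j^ w′)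
    j^w≋j^w′ = R₊.≋-trans {j^ w} {F⁻¹∘ S.op j ∘F} {j^ w′}
      (R₊.≋-sym {F⁻¹∘ S.op j ∘F} {j^ w} (F⁻¹-topology-F≋j^ j))
      (R₊.≋-trans {F⁻¹∘ S.op j ∘F} {F⁻¹∘ S.op j′ ∘F} {j^ w′} e (F⁻¹-topology-F≋j^ j′))

  -- By `bits-injective`, `w` has the bits of the word of `j`, whose zeros are downward closed.
  image-zerosThenOnes : ∀ w (j : S.Topology n) → (F⁻¹∘ S.op j ∘F) ≋₊ (j^ w) → ZerosThenOnes w
  image-zerosThenOnes w j e = downClosed⇒zerosThenOnes w λ a c c≤a a≡ →
    trans (bits≡ c) (zerosThenOnes⇒downClosed (topologyWord j) (topologyWord-zerosThenOnes j)
      a c c≤a (trans (sym (bits≡ a)) a≡))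
    where
    bits≡ : ∀ a → bits w a ≡ bits (topologyWord j) a
    bits≡ = bits-injective w (topologyWord j)
      (R₊.≋-trans {j^ w} {F⁻¹∘ S.op j ∘F} {j^ topologyWord j}
        (R₊.≋-sym {F⁻¹∘ S.op j ∘F} {j^ w} e) (F⁻¹-topology-F≋j^ j))

theorem47 : (n : ℕ) →
    Σ[ isTop ∈ ((j : S.Topology n) → S₊.IsTopology n (F⁻¹∘ S.op j ∘F)) ]
    ((w : Vec Bool (suc n)) →
    (Σ[ j ∈ S.Topology n ] (F⁻¹∘ S.op j ∘F) ≋₊ (j^ w)) ⇔ ZerosThenOnes w)
    × (Σ[ sorted ∈ ((j : S.Topology n) → ∃[ w ] ZerosThenOnes w × (F⁻¹∘ S.op j ∘F) ≋₊ (j^ w)) ]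
    IsBijection (_≋_ {n}) (_≋ₛ_ {n}) (F⁻¹-F isTop sorted))
theorem47 n =
    F⁻¹-F-isTopology
  , (λ w → mk⇔ (λ (j , e) → image-zerosThenOnes w j e)
               (λ zo → rigidTopology (bits w) , F⁻¹-rigid-F≋j^ w zo))
  , (λ j → topologyWord j , topologyWord-zerosThenOnes j , F⁻¹-topology-F≋j^ j)
  , record
    { isInjection = record
      { isCongruent = record
        { cong           = λ {j} {j′} → F⁻¹-F-cong {n} {S.op j} {S.op j′}
        ; isEquivalence₁ = On.isEquivalence S.op (Sieves.≋-isEquivalence (Δ≤ n))
        ; isEquivalence₂ = On.isEquivalence (λ t → S₊.op (proj₁ t)) (Sieves.≋-isEquivalence (Δ₊≤ n))
        }
      ; injective = λ {j} {j′} → F⁻¹-F-injective j j′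
      }
    -- Surjectivity is asked for every `z` equivalent to the witness, hence the detour through
    -- congruence.
    ; surjective = λ (t , w , zo , t≋j^w) → rigidTopology (bits w) , λ {z} z≋ →
        ≋₊-trans {F⁻¹∘ S.op z ∘F} {F⁻¹∘ rigid (bits w) ∘F} {S₊.op t}
          (F⁻¹-F-cong {n} {S.op z} {rigid (bits w)} z≋)
          (≋₊-trans {F⁻¹∘ rigid (bits w) ∘F} {j^ w} {S₊.op t} (F⁻¹-rigid-F≋j^ w zo)
            (≋₊-sym {S₊.op t} {j^ w} t≋j^w))
    }
  where
  open Sieves (Δ≤ n) using (rigid)
  open Sieves (Δ₊≤ n) using () renaming (≋-trans to ≋₊-trans; ≋-sym to ≋₊-sym)
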